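{- Let $a$ be a rational number with $a\in\mathbb{Z}_p$ (i.e. $|a|_p\le1$) for every prime $p$, and let $F(x)=\sum_{n=1}^{\infty}\binom an x^n$. If $x=(x_\infty,x_2,\dots,x_p,\dots)$ is an adele with $|x_v|_v<1$ for all $v\in\{\infty,2,3,\dots,p,\dots\}$, then the sequence $$\mathcal{F}(x)=\big(F(x_\infty),F(x_2),\dots,F(x_p),\dots\big)$$ is an adele.
   Context: $\binom an=\frac{a(a-1)\cdots(a-n+1)}{n!}$. $|\cdot|_\infty$ is the usual absolute value on $\mathbb{R}$; for a prime $p$, $|\cdot|_p$ is the $p$-adic absolute value on $\mathbb{Q}_p$, and $\mathbb{Z}_p$ is the ring of $p$-adic integers. An adele is an infinite sequence $a=(a_\infty,a_2,\dots,a_p,\dots)$, indexed by $\infty$ and the primes, in which $a_\infty\in\mathbb{R}$, $a_p\in\mathbb{Q}_p$ for each prime $p$, and $a_p\in\mathbb{Z}_p$ for all but finitely many $p$. $F(x_\infty)$ is the sum of the series in $\mathbb{R}$ and $F(x_p)$ is the sum of the series in $\mathbb{Q}_p$. -}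

module Defs where

open import Data.Bool.Base using (if_then_else_)
open import Data.Integer.Base as ℤ using (ℤ; +_)
import Data.Integer.Divisibility.Signed as ℤ∣
import Data.Integer.Properties as ℤ
open import Data.List.Base using (List)
open import Data.List.Membership.Propositional using (_∉_)
open import Data.Nat.Base as ℕ using (ℕ; zero; suc; z≤n; s≤s; _!)
open import Data.Nat.Divisibility
  using (_∣_; _∣?_; divides; *-pres-∣; ∣-trans; 1∣_; ∣⇒≤; *-cancelʳ-∣; *-monoˡ-∣; m∣m*n)
open import Data.Nat.Primality
  using (Prime; prime?; prime⇒nonZero; prime⇒nonTrivial; euclidsLemma)
import Data.Nat.Properties as ℕ
open import Data.Product.Base using (Σ-syntax; ∃-syntax; _×_; _,_; proj₁; proj₂)
open import Data.Rational.Base as ℚ using (ℚ; 0ℚ; 1ℚ; ½; ↥_; ↧_; ↧ₙ_; toℚᵘ)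
import Data.Rational.Properties as ℚ
open import Data.Rational.Solver using (module +-*-Solver)
import Data.Rational.Unnormalised.Base as ℚᵘ
import Data.Rational.Unnormalised.Properties as ℚᵘ
open import Data.Sum.Base using (_⊎_; inj₁; inj₂; [_,_]′)
open import Relation.Binary.PropositionalEquality
open import Relation.Nullary using (Dec; ¬_; does; yes; no; contradiction; recompute)
open import Relation.Nullary.Decidable using (dec-false)

------------------------------------------------------------------------
-- Places of ℚ and their absolute values

-- The primality proof is irrelevant so that each prime gives exactly
-- one place.
data Place : Set where
  ∞   : Place
  fin : (p : ℕ) → .(Prime p) → Place

largestExponent : (p n bound : ℕ) → ℕ
largestExponent p n zero    = 0
largestExponent p n (suc k) =
  if does (p ℕ.^ suc k ∣? n) then suc k else largestExponent p n k

-- The exponent of p in n.  For p ≥ 2 and n ≥ 1 searching only up to n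
-- loses nothing, since pᵏ ∣ n gives k < pᵏ ≤ n.
ord : ℕ → ℕ → ℕ
ord p n = largestExponent p n n

-- The record{} pattern, as in Data.Rational.Base, keeps padicAbs p q
-- from unfolding while q is neutral.
padicAbs : (p : ℕ) .{{_ : ℕ.NonZero p}} → ℚ → ℚ
padicAbs p q@record{} =
  if does (q ℚ.≟ 0ℚ) then 0ℚ
  else ((+ (p ℕ.^ ord p (↧ₙ q))) ℚ./ (p ℕ.^ ord p ℤ.∣ ↥ q ∣))
         {{ℕ.m^n≢0 p (ord p ℤ.∣ ↥ q ∣)}}

absAt : Place → ℚ → ℚ
absAt ∞          q = ℚ.∣ q ∣
absAt (fin p pr) q = padicAbs p {{prime⇒nonZero pr}} q

------------------------------------------------------------------------
-- Properties of ord

largestExponent-∣ : ∀ p n k → p ℕ.^ largestExponent p n k ∣ n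
largestExponent-∣ p n zero    = 1∣ n
largestExponent-∣ p n (suc k) with p ℕ.^ suc k ∣? n
... | yes d = d
... | no  _ = largestExponent-∣ p n k

largestExponent-max : ∀ p n k {j} → j ℕ.≤ k → p ℕ.^ j ∣ n → j ℕ.≤ largestExponent p n k
largestExponent-max p n zero    j≤k d = j≤k
largestExponent-max p n (suc k) {j} j≤k d with p ℕ.^ suc k ∣? n
... | yes _ = j≤k
... | no ¬d with ℕ.m≤n⇒m<n∨m≡n j≤k
...   | inj₁ (s≤s j≤k′) = largestExponent-max p n k j≤k′ d
...   | inj₂ refl       = contradiction d ¬d

n<p^n : ∀ p .{{_ : ℕ.NonTrivial p}} n → n ℕ.< p ℕ.^ n
n<p^n p zero    = s≤s z≤n
n<p^n p (suc n) = begin-strict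
  suc n               ≤⟨ n<p^n p n ⟩
  p ℕ.^ n             <⟨ ℕ.m<m*n (p ℕ.^ n) p {{ℕ.m^n≢0 p n {{ℕ.nonTrivial⇒nonZero p}}}} (ℕ.nonTrivial⇒n>1 p) ⟩
  p ℕ.^ n ℕ.* p       ≡⟨ ℕ.*-comm (p ℕ.^ n) p ⟩
  p ℕ.^ suc n         ∎
  where open ℕ.≤-Reasoning

p^ord∣n : ∀ p n → p ℕ.^ ord p n ∣ n
p^ord∣n p n = largestExponent-∣ p n n

ord-max : ∀ p .{{_ : ℕ.NonTrivial p}} n .{{_ : ℕ.NonZero n}} {k} →
          p ℕ.^ k ∣ n → k ℕ.≤ ord p n
ord-max p n {k} d =
  largestExponent-max p n n (ℕ.≤-trans (ℕ.<⇒≤ (n<p^n p k)) (∣⇒≤ d)) d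

m≤n⇒p^m∣p^n : ∀ p {m n} → m ℕ.≤ n → p ℕ.^ m ∣ p ℕ.^ n
m≤n⇒p^m∣p^n p {m} {n} m≤n =
  subst (p ℕ.^ m ∣_)
    (trans (sym (ℕ.^-distribˡ-+-* p m (n ℕ.∸ m))) (cong (p ℕ.^_) (ℕ.m+[n∸m]≡n m≤n)))
    (m∣m*n (p ℕ.^ (n ℕ.∸ m)))

ord-* : ∀ p → Prime p → ∀ m n .{{_ : ℕ.NonZero m}} .{{_ : ℕ.NonZero n}} →
        ord p (m ℕ.* n) ≡ ord p m ℕ.+ ord p n
ord-* p pr m n with p^ord∣n p m in em | p^ord∣n p n in en
... | divides u mu | divides w nw =
  ℕ.≤-antisym (ℕ.≮⇒≥ upper) (ord-max p (m ℕ.* n) lower)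
  where
  instance
    _ = prime⇒nonZero pr
    _ = prime⇒nonTrivial pr
    _ = ℕ.m*n≢0 m n
    _ = ℕ.m^n≢0 p (ord p m ℕ.+ ord p n)

  a b : ℕ
  a = ord p m
  b = ord p n

  lower : p ℕ.^ (a ℕ.+ b) ∣ m ℕ.* n
  lower = subst (_∣ m ℕ.* n) (sym (ℕ.^-distribˡ-+-* p a b))
                (*-pres-∣ (p^ord∣n p m) (p^ord∣n p n))

  notDiv : ∀ k .{{_ : ℕ.NonZero k}} v → k ≡ v ℕ.* p ℕ.^ ord p k → ¬ p ∣ v
  notDiv k v kv p∣v = ℕ.1+n≰n (ord-max p k (subst (p ℕ.^ suc (ord p k) ∣_) (sym kv)
                        (*-monoˡ-∣ (p ℕ.^ ord p k) p∣v)))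

  mn≡ : m ℕ.* n ≡ (u ℕ.* w) ℕ.* p ℕ.^ (a ℕ.+ b)
  mn≡ = begin
    m ℕ.* n                                      ≡⟨ cong₂ ℕ._*_ mu nw ⟩
    (u ℕ.* p ℕ.^ a) ℕ.* (w ℕ.* p ℕ.^ b)          ≡⟨ ℕ.[m*n]*[o*p]≡[m*o]*[n*p] u (p ℕ.^ a) w (p ℕ.^ b) ⟩
    (u ℕ.* w) ℕ.* (p ℕ.^ a ℕ.* p ℕ.^ b)          ≡⟨ cong (u ℕ.* w ℕ.*_) (ℕ.^-distribˡ-+-* p a b) ⟨
    (u ℕ.* w) ℕ.* p ℕ.^ (a ℕ.+ b)                ∎
    where open ≡-Reasoning

  upper : ¬ (a ℕ.+ b ℕ.< ord p (m ℕ.* n))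
  upper lt = [ notDiv m u mu , notDiv n w nw ]′ (euclidsLemma u w pr p∣uw)
    where
    p∣uw : p ∣ u ℕ.* w
    p∣uw = *-cancelʳ-∣ (p ℕ.^ (a ℕ.+ b))
             (subst (p ℕ.^ suc (a ℕ.+ b) ∣_) mn≡
               (∣-trans (m≤n⇒p^m∣p^n p lt) (p^ord∣n p (m ℕ.* n))))

------------------------------------------------------------------------
-- Fractions of natural numbers

frac : (m n : ℕ) .{{_ : ℕ.NonZero n}} → ℚ
frac m n = (+ m) ℚ./ n

toℚᵘ-frac : ∀ m n .{{_ : ℕ.NonZero n}} → toℚᵘ (frac m n) ℚᵘ.≃ ((+ m) ℚᵘ./ n)
toℚᵘ-frac m (suc n) = ℚ.toℚᵘ-fromℚᵘ (ℚᵘ.mkℚᵘ (+ m) n)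

frac-≡ : ∀ a b c d .{{_ : ℕ.NonZero b}} .{{_ : ℕ.NonZero d}} →
         a ℕ.* d ≡ c ℕ.* b → frac a b ≡ frac c d
frac-≡ a (suc b) c (suc d) eq = ℚ.fromℚᵘ-cong {ℚᵘ.mkℚᵘ (+ a) b} {ℚᵘ.mkℚᵘ (+ c) d}
  (ℚᵘ.*≡* (trans (sym (ℤ.pos-* a (suc d))) (trans (cong +_ eq) (ℤ.pos-* c (suc b)))))

frac-≤ : ∀ a b c d .{{_ : ℕ.NonZero b}} .{{_ : ℕ.NonZero d}} →
         a ℕ.* d ℕ.≤ c ℕ.* b → frac a b ℚ.≤ frac c d
frac-≤ a b@(suc b-1) c d@(suc d-1) le = ℚ.toℚᵘ-cancel-≤ (begin
  toℚᵘ (frac a b)  ≃⟨ toℚᵘ-frac a b ⟩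
  (+ a) ℚᵘ./ b     ≤⟨ ℚᵘ.*≤* (subst₂ ℤ._≤_ (ℤ.pos-* a d) (ℤ.pos-* c b) (ℤ.+≤+ le)) ⟩
  (+ c) ℚᵘ./ d     ≃⟨ toℚᵘ-frac c d ⟨
  toℚᵘ (frac c d)  ∎)
  where open ℚᵘ.≤-Reasoning

frac-* : ∀ a b c d .{{_ : ℕ.NonZero b}} .{{_ : ℕ.NonZero d}} .{{_ : ℕ.NonZero (b ℕ.* d)}} →
         frac a b ℚ.* frac c d ≡ frac (a ℕ.* c) (b ℕ.* d)
frac-* a b@(suc b-1) c d@(suc d-1) = ℚ.toℚᵘ-injective (begin
  toℚᵘ (frac a b ℚ.* frac c d)              ≈⟨ ℚ.toℚᵘ-homo-* (frac a b) (frac c d) ⟩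
  toℚᵘ (frac a b) ℚᵘ.* toℚᵘ (frac c d)      ≈⟨ ℚᵘ.*-cong (toℚᵘ-frac a b) (toℚᵘ-frac c d) ⟩
  ((+ a) ℚᵘ./ b) ℚᵘ.* ((+ c) ℚᵘ./ d)        ≈⟨ ℚᵘ.≃-reflexive (cong (λ z → z ℚᵘ./ (b ℕ.* d)) (sym (ℤ.pos-* a c))) ⟩
  (+ (a ℕ.* c)) ℚᵘ./ (b ℕ.* d)              ≈⟨ toℚᵘ-frac (a ℕ.* c) (b ℕ.* d) ⟨
  toℚᵘ (frac (a ℕ.* c) (b ℕ.* d))           ∎)
  where open import Relation.Binary.Reasoning.Setoid ℚᵘ.≃-setoid

0≤frac : ∀ a b .{{_ : ℕ.NonZero b}} → 0ℚ ℚ.≤ frac a b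
0≤frac a b = frac-≤ 0 1 a b z≤n

------------------------------------------------------------------------
-- Properties of the p-adic absolute value

∣n∣≢0 : ∀ {q} → q ≢ 0ℚ → ℕ.NonZero ℤ.∣ ↥ q ∣
∣n∣≢0 {q} q≢0 = ℕ.≢-nonZero λ eq → q≢0 (ℚ.↥p≡0⇒p≡0 q (ℤ.∣i∣≡0⇒i≡0 eq))

module PAdic (p : ℕ) (pr : Prime p) where
  private instance
    p≢0 = prime⇒nonZero pr
    p-nonTrivial = prime⇒nonTrivial pr

  ∣_∣ₚ : ℚ → ℚ
  ∣_∣ₚ = padicAbs p

  -- p ^ ord p d / p ^ ord p m
  ratio : ℕ → ℕ → ℚ
  ratio m d = frac (p ℕ.^ ord p d) (p ℕ.^ ord p m) {{ℕ.m^n≢0 p (ord p m)}}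

  0-abs : ∣ 0ℚ ∣ₚ ≡ 0ℚ
  0-abs = refl

  abs-≢0 : ∀ {q} → q ≢ 0ℚ → ∣ q ∣ₚ ≡ ratio ℤ.∣ ↥ q ∣ (↧ₙ q)
  abs-≢0 {q@record{}} q≢0 =
    cong (λ b → if b then 0ℚ else ratio ℤ.∣ ↥ q ∣ (↧ₙ q)) (dec-false (q ℚ.≟ 0ℚ) q≢0)

  ratio-cong : ∀ m d n e .{{_ : ℕ.NonZero m}} .{{_ : ℕ.NonZero d}}
               .{{_ : ℕ.NonZero n}} .{{_ : ℕ.NonZero e}} →
               m ℕ.* e ≡ n ℕ.* d → ratio m d ≡ ratio n e
  ratio-cong m d n e eq =
    frac-≡ (p ℕ.^ ord p d) (p ℕ.^ ord p m) (p ℕ.^ ord p e) (p ℕ.^ ord p n)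
      {{ℕ.m^n≢0 p (ord p m)}} {{ℕ.m^n≢0 p (ord p n)}} (begin
      p ℕ.^ ord p d ℕ.* p ℕ.^ ord p n    ≡⟨ ℕ.^-distribˡ-+-* p (ord p d) (ord p n) ⟨
      p ℕ.^ (ord p d ℕ.+ ord p n)        ≡⟨ cong (p ℕ.^_) (ℕ.+-comm (ord p d) (ord p n)) ⟩
      p ℕ.^ (ord p n ℕ.+ ord p d)        ≡⟨ cong (p ℕ.^_) (ord-* p pr n d) ⟨
      p ℕ.^ ord p (n ℕ.* d)              ≡⟨ cong (λ k → p ℕ.^ ord p k) eq ⟨
      p ℕ.^ ord p (m ℕ.* e)              ≡⟨ cong (p ℕ.^_) (ord-* p pr m e) ⟩
      p ℕ.^ (ord p m ℕ.+ ord p e)        ≡⟨ cong (p ℕ.^_) (ℕ.+-comm (ord p m) (ord p e)) ⟩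
      p ℕ.^ (ord p e ℕ.+ ord p m)        ≡⟨ ℕ.^-distribˡ-+-* p (ord p e) (ord p m) ⟩
      p ℕ.^ ord p e ℕ.* p ℕ.^ ord p m    ∎)
    where open ≡-Reasoning

  ratio-* : ∀ m d n e .{{_ : ℕ.NonZero m}} .{{_ : ℕ.NonZero d}}
            .{{_ : ℕ.NonZero n}} .{{_ : ℕ.NonZero e}} →
            ratio (m ℕ.* n) (d ℕ.* e) ≡ ratio m d ℚ.* ratio n e
  ratio-* m d n e = sym (begin
    ratio m d ℚ.* ratio n e   ≡⟨ frac-* (p ℕ.^ ord p d) (p ℕ.^ ord p m) (p ℕ.^ ord p e) (p ℕ.^ ord p n) ⟩
    frac (p ℕ.^ ord p d ℕ.* p ℕ.^ ord p e) (p ℕ.^ ord p m ℕ.* p ℕ.^ ord p n)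
                              ≡⟨ frac-≡ (p ℕ.^ ord p d ℕ.* p ℕ.^ ord p e) (p ℕ.^ ord p m ℕ.* p ℕ.^ ord p n) (p ℕ.^ ord p (d ℕ.* e)) (p ℕ.^ ord p (m ℕ.* n)) (cong₂ ℕ._*_ (pow d e) (sym (pow m n))) ⟩
    ratio (m ℕ.* n) (d ℕ.* e) ∎)
    where
    open ≡-Reasoning
    instance
      _ = ℕ.m^n≢0 p (ord p m)
      _ = ℕ.m^n≢0 p (ord p n)
      _ = ℕ.m^n≢0 p (ord p (m ℕ.* n))
      _ = ℕ.m*n≢0 (p ℕ.^ ord p m) (p ℕ.^ ord p n)
    pow : ∀ i j .{{_ : ℕ.NonZero i}} .{{_ : ℕ.NonZero j}} →
          p ℕ.^ ord p i ℕ.* p ℕ.^ ord p j ≡ p ℕ.^ ord p (i ℕ.* j)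
    pow i j = trans (sym (ℕ.^-distribˡ-+-* p (ord p i) (ord p j)))
                    (cong (p ℕ.^_) (sym (ord-* p pr i j)))

  -- The absolute value may be computed from any fraction i / d
  -- representing q, not only from the reduced one.
  abs-fraction : ∀ {q} → q ≢ 0ℚ → ∀ i d .{{_ : ℕ.NonZero d}} →
                 ↥ q ℤ.* (+ d) ≡ i ℤ.* ↧ q → ℕ.NonZero ℤ.∣ i ∣ × ∣ q ∣ₚ ≡ ratio ℤ.∣ i ∣ d
  abs-fraction {q@record{}} q≢0 i d eq =
    i≢0 , trans (abs-≢0 q≢0) (ratio-cong ℤ.∣ ↥ q ∣ (↧ₙ q) ℤ.∣ i ∣ d {{∣n∣≢0 q≢0}} {{_}} {{i≢0}} ∣eq∣)
    where
    ∣eq∣ : ℤ.∣ ↥ q ∣ ℕ.* d ≡ ℤ.∣ i ∣ ℕ.* ↧ₙ q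
    ∣eq∣ = trans (sym (ℤ.abs-* (↥ q) (+ d))) (trans (cong ℤ.∣_∣ eq) (ℤ.abs-* i (↧ q)))
    i≢0 : ℕ.NonZero ℤ.∣ i ∣
    i≢0 = ℕ.m*n≢0⇒m≢0 ℤ.∣ i ∣ {{subst ℕ.NonZero ∣eq∣ (ℕ.m*n≢0 ℤ.∣ ↥ q ∣ d {{∣n∣≢0 q≢0}})}}

  abs-nonNeg : ∀ q → 0ℚ ℚ.≤ ∣ q ∣ₚ
  abs-nonNeg q = helper (q ℚ.≟ 0ℚ)
    where
    helper : Dec (q ≡ 0ℚ) → 0ℚ ℚ.≤ ∣ q ∣ₚ
    helper (yes q≡0) = ℚ.≤-reflexive (sym (cong ∣_∣ₚ q≡0))
    helper (no q≢0)  = subst (0ℚ ℚ.≤_) (sym (abs-≢0 q≢0))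
      (0≤frac (p ℕ.^ ord p (↧ₙ q)) (p ℕ.^ ord p ℤ.∣ ↥ q ∣) {{ℕ.m^n≢0 p (ord p ℤ.∣ ↥ q ∣)}})

  abs-neg : ∀ q → ∣ ℚ.- q ∣ₚ ≡ ∣ q ∣ₚ
  abs-neg q = helper (q ℚ.≟ 0ℚ)
    where
    open ≡-Reasoning
    helper : Dec (q ≡ 0ℚ) → ∣ ℚ.- q ∣ₚ ≡ ∣ q ∣ₚ
    helper (yes refl) = refl
    helper (no q≢0)   = begin
      ∣ ℚ.- q ∣ₚ                          ≡⟨ abs-≢0 (λ e → q≢0 (ℚ.neg-injective e)) ⟩
      ratio ℤ.∣ ↥ (ℚ.- q) ∣ (↧ₙ (ℚ.- q))  ≡⟨ cong₂ ratio (trans (cong ℤ.∣_∣ (ℚ.↥-neg q)) (ℤ.∣-i∣≡∣i∣ (↥ q)))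
                                                       (ℤ.+-injective (ℚ.↧-neg q)) ⟩
      ratio ℤ.∣ ↥ q ∣ (↧ₙ q)              ≡⟨ abs-≢0 q≢0 ⟨
      ∣ q ∣ₚ                              ∎

  abs-* : ∀ q r → ∣ q ℚ.* r ∣ₚ ≡ ∣ q ∣ₚ ℚ.* ∣ r ∣ₚ
  abs-* q r = helper (q ℚ.≟ 0ℚ) (r ℚ.≟ 0ℚ)
    where
    helper : Dec (q ≡ 0ℚ) → Dec (r ≡ 0ℚ) → ∣ q ℚ.* r ∣ₚ ≡ ∣ q ∣ₚ ℚ.* ∣ r ∣ₚ
    helper (yes refl) _ = trans (cong ∣_∣ₚ (ℚ.*-zeroˡ r)) (sym (ℚ.*-zeroˡ ∣ r ∣ₚ))
    helper _ (yes refl) = trans (cong ∣_∣ₚ (ℚ.*-zeroʳ q)) (sym (ℚ.*-zeroʳ ∣ q ∣ₚ))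
    helper (no q≢0) (no r≢0) = begin
      ∣ q ℚ.* r ∣ₚ                                           ≡⟨ proj₂ (abs-fraction qr≢0 (↥ q ℤ.* ↥ r) (↧ₙ q ℕ.* ↧ₙ r) repr) ⟩
      ratio ℤ.∣ ↥ q ℤ.* ↥ r ∣ (↧ₙ q ℕ.* ↧ₙ r)                ≡⟨ cong (λ k → ratio k (↧ₙ q ℕ.* ↧ₙ r)) (ℤ.abs-* (↥ q) (↥ r)) ⟩
      ratio (ℤ.∣ ↥ q ∣ ℕ.* ℤ.∣ ↥ r ∣) (↧ₙ q ℕ.* ↧ₙ r)        ≡⟨ ratio-* ℤ.∣ ↥ q ∣ (↧ₙ q) ℤ.∣ ↥ r ∣ (↧ₙ r) ⟩
      ratio ℤ.∣ ↥ q ∣ (↧ₙ q) ℚ.* ratio ℤ.∣ ↥ r ∣ (↧ₙ r)      ≡⟨ cong₂ ℚ._*_ (abs-≢0 q≢0) (abs-≢0 r≢0) ⟨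
      ∣ q ∣ₚ ℚ.* ∣ r ∣ₚ                                      ∎
      where
      open ≡-Reasoning
      instance
        _ = ∣n∣≢0 q≢0
        _ = ∣n∣≢0 r≢0
      repr : ↥ (q ℚ.* r) ℤ.* (+ (↧ₙ q ℕ.* ↧ₙ r)) ≡ (↥ q ℤ.* ↥ r) ℤ.* ↧ (q ℚ.* r)
      repr = toCross (q ℚ.* r) q r (ℚ.toℚᵘ-homo-* q r)
        where
        toCross : ∀ s q r → toℚᵘ s ℚᵘ.≃ toℚᵘ q ℚᵘ.* toℚᵘ r →
                  ↥ s ℤ.* (+ (↧ₙ q ℕ.* ↧ₙ r)) ≡ (↥ q ℤ.* ↥ r) ℤ.* ↧ s
        toCross record{} record{} record{} (ℚᵘ.*≡* e) = e
      qr≢0 : q ℚ.* r ≢ 0ℚ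
      qr≢0 e = ℕ.≢-nonZero⁻¹ _ {{ℕ.m*n≢0 ℤ.∣ ↥ q ∣ ℤ.∣ ↥ r ∣}}
        (trans (sym (ℤ.abs-* (↥ q) (↥ r)))
          (cong ℤ.∣_∣ (ℤ.*-cancelʳ-≡ (↥ q ℤ.* ↥ r) (+ 0) (+ 1) (trans (cong ((↥ q ℤ.* ↥ r) ℤ.*_) (cong ↧_ (sym e)))
             (trans (sym repr) (cong (λ s → ↥ s ℤ.* (+ (↧ₙ q ℕ.* ↧ₙ r))) e))))))

  ultrametric : ∀ q r → ∣ q ℚ.+ r ∣ₚ ℚ.≤ ∣ q ∣ₚ ⊎ ∣ q ℚ.+ r ∣ₚ ℚ.≤ ∣ r ∣ₚ
  ultrametric q r = helper (q ℚ.≟ 0ℚ) (r ℚ.≟ 0ℚ) (q ℚ.+ r ℚ.≟ 0ℚ)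
    where
    helper : Dec (q ≡ 0ℚ) → Dec (r ≡ 0ℚ) → Dec (q ℚ.+ r ≡ 0ℚ) →
             ∣ q ℚ.+ r ∣ₚ ℚ.≤ ∣ q ∣ₚ ⊎ ∣ q ℚ.+ r ∣ₚ ℚ.≤ ∣ r ∣ₚ
    helper (yes refl) _ _ = inj₂ (ℚ.≤-reflexive (cong ∣_∣ₚ (ℚ.+-identityˡ r)))
    helper _ (yes refl) _ = inj₁ (ℚ.≤-reflexive (cong ∣_∣ₚ (ℚ.+-identityʳ q)))
    helper _ _ (yes e) = inj₁ (subst (ℚ._≤ ∣ q ∣ₚ) (sym (cong ∣_∣ₚ e)) (abs-nonNeg q))
    helper (no q≢0) (no r≢0) (no q+r≢0) = result
      where
      i j : ℤ
      i = ↥ q ℤ.* ↧ r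
      j = ↥ r ℤ.* ↧ q
      d : ℕ
      d = ↧ₙ q ℕ.* ↧ₙ r
      repr₊ : ↥ (q ℚ.+ r) ℤ.* (+ d) ≡ (i ℤ.+ j) ℤ.* ↧ (q ℚ.+ r)
      repr₊ = toCross (q ℚ.+ r) q r (ℚ.toℚᵘ-homo-+ q r)
        where
        toCross : ∀ s q r → toℚᵘ s ℚᵘ.≃ toℚᵘ q ℚᵘ.+ toℚᵘ r →
                  ↥ s ℤ.* (+ (↧ₙ q ℕ.* ↧ₙ r)) ≡ (↥ q ℤ.* ↧ r ℤ.+ ↥ r ℤ.* ↧ q) ℤ.* ↧ s
        toCross record{} record{} record{} (ℚᵘ.*≡* e) = e
      repr₁ : ↥ q ℤ.* (+ d) ≡ i ℤ.* ↧ q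
      repr₁ = trans (cong (↥ q ℤ.*_) (trans (ℤ.pos-* (↧ₙ q) (↧ₙ r)) (ℤ.*-comm (↧ q) (↧ r))))
                    (sym (ℤ.*-assoc (↥ q) (↧ r) (↧ q)))
      repr₂ : ↥ r ℤ.* (+ d) ≡ j ℤ.* ↧ r
      repr₂ = trans (cong (↥ r ℤ.*_) (ℤ.pos-* (↧ₙ q) (↧ₙ r)))
                    (sym (ℤ.*-assoc (↥ r) (↧ q) (↧ r)))
      A = abs-fraction q≢0 i d repr₁
      B = abs-fraction r≢0 j d repr₂
      C = abs-fraction q+r≢0 (i ℤ.+ j) d repr₊
      instance
        i≢0 = proj₁ A
        j≢0 = proj₁ B
        i+j≢0 = proj₁ C
      p^k∣ : ∀ {k} → k ℕ.≤ ord p ℤ.∣ i ∣ → k ℕ.≤ ord p ℤ.∣ j ∣ → k ℕ.≤ ord p ℤ.∣ i ℤ.+ j ∣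
      p^k∣ {k} k≤i k≤j = ord-max p ℤ.∣ i ℤ.+ j ∣
        (ℤ∣.∣⇒∣ᵤ (ℤ∣.∣m∣n⇒∣m+n {+ (p ℕ.^ k)} {i} {j}
          (ℤ∣.∣ᵤ⇒∣ (∣-trans (m≤n⇒p^m∣p^n p k≤i) (p^ord∣n p ℤ.∣ i ∣)))
          (ℤ∣.∣ᵤ⇒∣ (∣-trans (m≤n⇒p^m∣p^n p k≤j) (p^ord∣n p ℤ.∣ j ∣)))))
      ratio-≤ : ∀ m n → ord p m ℕ.≤ ord p n → ratio n d ℚ.≤ ratio m d
      ratio-≤ m n le = frac-≤ (p ℕ.^ ord p d) (p ℕ.^ ord p n) (p ℕ.^ ord p d) (p ℕ.^ ord p m)
                         {{ℕ.m^n≢0 p (ord p n)}} {{ℕ.m^n≢0 p (ord p m)}}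
                         (ℕ.*-monoʳ-≤ (p ℕ.^ ord p d) (ℕ.^-monoʳ-≤ p le))
      result : ∣ q ℚ.+ r ∣ₚ ℚ.≤ ∣ q ∣ₚ ⊎ ∣ q ℚ.+ r ∣ₚ ℚ.≤ ∣ r ∣ₚ
      result = [ (λ le → inj₁ (subst₂ ℚ._≤_ (sym (proj₂ C)) (sym (proj₂ A))
                          (ratio-≤ ℤ.∣ i ∣ ℤ.∣ i ℤ.+ j ∣ (p^k∣ ℕ.≤-refl le))))
               , (λ le → inj₂ (subst₂ ℚ._≤_ (sym (proj₂ C)) (sym (proj₂ B))
                          (ratio-≤ ℤ.∣ j ∣ ℤ.∣ i ℤ.+ j ∣ (p^k∣ le ℕ.≤-refl))))
               ]′ (ℕ.≤-total (ord p ℤ.∣ i ∣) (ord p ℤ.∣ j ∣))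

  abs-triangle : ∀ q r → ∣ q ℚ.+ r ∣ₚ ℚ.≤ ∣ q ∣ₚ ℚ.+ ∣ r ∣ₚ
  abs-triangle q r = ≤-max⇒≤-sum (abs-nonNeg q) (abs-nonNeg r) (ultrametric q r)
    where
    ≤-max⇒≤-sum : ∀ {x y z} → 0ℚ ℚ.≤ x → 0ℚ ℚ.≤ y → z ℚ.≤ x ⊎ z ℚ.≤ y → z ℚ.≤ x ℚ.+ y
    ≤-max⇒≤-sum {x} {y} _ 0≤y (inj₁ le) =
      ℚ.≤-trans le (subst (ℚ._≤ x ℚ.+ y) (ℚ.+-identityʳ x) (ℚ.+-monoʳ-≤ x 0≤y))
    ≤-max⇒≤-sum {x} {y} 0≤x _ (inj₂ le) =
      ℚ.≤-trans le (subst (ℚ._≤ x ℚ.+ y) (ℚ.+-identityˡ y) (ℚ.+-monoˡ-≤ y 0≤x))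

------------------------------------------------------------------------
-- Absolute values at an arbitrary place

toPrime : ∀ p → .(Prime p) → Prime p
toPrime p pr = recompute (prime? p) pr

absAt-0 : ∀ v → absAt v 0ℚ ≡ 0ℚ
absAt-0 ∞          = refl
absAt-0 (fin p pr) = refl

absAt-nonNeg : ∀ v q → 0ℚ ℚ.≤ absAt v q
absAt-nonNeg ∞          = ℚ.0≤∣p∣
absAt-nonNeg (fin p pr) = PAdic.abs-nonNeg p (toPrime p pr)

absAt-neg : ∀ v q → absAt v (ℚ.- q) ≡ absAt v q
absAt-neg ∞          = ℚ.∣-p∣≡∣p∣
absAt-neg (fin p pr) = PAdic.abs-neg p (toPrime p pr)

absAt-* : ∀ v q r → absAt v (q ℚ.* r) ≡ absAt v q ℚ.* absAt v r
absAt-* ∞          = ℚ.∣p*q∣≡∣p∣*∣q∣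
absAt-* (fin p pr) = PAdic.abs-* p (toPrime p pr)

absAt-+ : ∀ v q r → absAt v (q ℚ.+ r) ℚ.≤ absAt v q ℚ.+ absAt v r
absAt-+ ∞          = ℚ.∣p+q∣≤∣p∣+∣q∣
absAt-+ (fin p pr) = PAdic.abs-triangle p (toPrime p pr)

absAt-swap : ∀ v q r → absAt v (q ℚ.- r) ≡ absAt v (r ℚ.- q)
absAt-swap v q r = trans (sym (absAt-neg v (q ℚ.- r))) (cong (absAt v) (swap q r))
  where
  open +-*-Solver
  swap : ∀ q r → ℚ.- (q ℚ.- r) ≡ r ℚ.- q
  swap = solve 2 (λ q r → :- (q :- r) := r :- q) refl

absAt-≤ : ∀ v q r → absAt v q ℚ.≤ absAt v (q ℚ.- r) ℚ.+ absAt v r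
absAt-≤ v q r = subst (λ s → absAt v s ℚ.≤ absAt v (q ℚ.- r) ℚ.+ absAt v r)
                      (cancel q r) (absAt-+ v (q ℚ.- r) r)
  where
  open +-*-Solver
  cancel : ∀ q r → q ℚ.- r ℚ.+ r ≡ q
  cancel = solve 2 (λ q r → q :- r :+ r := q) refl

reverse-triangle : ∀ v q r → ℚ.∣ absAt v q ℚ.- absAt v r ∣ ℚ.≤ absAt v (q ℚ.- r)
reverse-triangle v q r = [ case₁ , case₂ ]′ (ℚ.∣p∣≡p∨∣p∣≡-p (absAt v q ℚ.- absAt v r))
  where
  open +-*-Solver
  ≤+⇒-≤ : ∀ {x y z} → x ℚ.≤ z ℚ.+ y → x ℚ.- y ℚ.≤ z
  ≤+⇒-≤ {x} {y} {z} le = subst (x ℚ.- y ℚ.≤_)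
    (solve 2 (λ z y → z :+ y :- y := z) refl z y) (ℚ.+-monoˡ-≤ (ℚ.- y) le)
  case₁ : ℚ.∣ absAt v q ℚ.- absAt v r ∣ ≡ absAt v q ℚ.- absAt v r →
          ℚ.∣ absAt v q ℚ.- absAt v r ∣ ℚ.≤ absAt v (q ℚ.- r)
  case₁ e = ℚ.≤-trans (ℚ.≤-reflexive e) (≤+⇒-≤ (absAt-≤ v q r))
  case₂ : ℚ.∣ absAt v q ℚ.- absAt v r ∣ ≡ ℚ.- (absAt v q ℚ.- absAt v r) →
          ℚ.∣ absAt v q ℚ.- absAt v r ∣ ℚ.≤ absAt v (q ℚ.- r)
  case₂ e = ℚ.≤-trans
    (ℚ.≤-reflexive (trans e (solve 2 (λ x y → :- (x :- y) := y :- x) refl (absAt v q) (absAt v r))))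
    (subst (absAt v r ℚ.- absAt v q ℚ.≤_) (absAt-swap v r q) (≤+⇒-≤ (absAt-≤ v r q)))

------------------------------------------------------------------------
-- The completion of ℚ at a place: ℝ at ∞ and ℚₚ at p

IsCauchy : Place → (ℕ → ℚ) → Set
IsCauchy v s = ∀ ε → 0ℚ ℚ.< ε →
  ∃[ N ] (∀ m n → N ℕ.≤ m → N ℕ.≤ n → absAt v (s m ℚ.- s n) ℚ.< ε)

-- There are no quotients: an element is a Cauchy sequence, and two
-- sequences denote the same number when their difference tends to 0.
-- Everything below is insensitive to the choice of representative.
record ℚ[_] (v : Place) : Set where
  constructor completion
  field
    seq    : ℕ → ℚ
    cauchy : IsCauchy v seq

open ℚ[_] public

ℝ : Set
ℝ = ℚ[ ∞ ]

private
  0<½* : ∀ {ε} → 0ℚ ℚ.< ε → 0ℚ ℚ.< ½ ℚ.* ε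
  0<½* 0<ε = ℚ.*-monoʳ-<-pos ½ 0<ε

  ½+½ : ∀ ε → ½ ℚ.* ε ℚ.+ ½ ℚ.* ε ≡ ε
  ½+½ = solve 1 (λ ε → con ½ :* ε :+ con ½ :* ε := ε) refl
    where open +-*-Solver

  bounded : ∀ {v} (x : ℚ[ v ]) →
            ∃[ B ] 0ℚ ℚ.< B × ∃[ N ] (∀ n → N ℕ.≤ n → absAt v (seq x n) ℚ.≤ B)
  bounded {v} x with cauchy x 1ℚ (ℚ.positive⁻¹ 1ℚ)
  ... | N , close = 1ℚ ℚ.+ absAt v (seq x N)
      , ℚ.<-≤-trans (ℚ.positive⁻¹ 1ℚ)
          (subst (ℚ._≤ 1ℚ ℚ.+ absAt v (seq x N)) (ℚ.+-identityʳ 1ℚ)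
            (ℚ.+-monoʳ-≤ 1ℚ (absAt-nonNeg v (seq x N))))
      , N , λ n N≤n → ℚ.≤-trans (absAt-≤ v (seq x n) (seq x N))
          (ℚ.+-monoˡ-≤ (absAt v (seq x N)) (ℚ.<⇒≤ (close n N N≤n ℕ.≤-refl)))

ι : ∀ {v} → ℚ → ℚ[ v ]
ι {v} q = completion (λ _ → q) λ ε 0<ε → 0 , λ _ _ _ _ →
  subst (ℚ._< ε) (sym (trans (cong (absAt v) (ℚ.+-inverseʳ q)) (absAt-0 v))) 0<ε

infixl 6 _+_ _-_
infixl 7 _*_
infix  8 -_
infixr 8 _^_

_+_ : ∀ {v} → ℚ[ v ] → ℚ[ v ] → ℚ[ v ]
_+_ {v} x y = completion (λ n → seq x n ℚ.+ seq y n) cauchy-+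
  where
  open ℚ.≤-Reasoning
  regroup : ∀ a b c d → (a ℚ.+ b) ℚ.- (c ℚ.+ d) ≡ (a ℚ.- c) ℚ.+ (b ℚ.- d)
  regroup = solve 4 (λ a b c d → (a :+ b) :- (c :+ d) := (a :- c) :+ (b :- d)) refl
    where open +-*-Solver
  cauchy-+ : IsCauchy v (λ n → seq x n ℚ.+ seq y n)
  cauchy-+ ε 0<ε with cauchy x (½ ℚ.* ε) (0<½* 0<ε) | cauchy y (½ ℚ.* ε) (0<½* 0<ε)
  ... | M , closeˣ | N , closeʸ = M ℕ.⊔ N , λ m n ≤m ≤n → begin-strict
    absAt v ((seq x m ℚ.+ seq y m) ℚ.- (seq x n ℚ.+ seq y n))
      ≡⟨ cong (absAt v) (regroup (seq x m) (seq y m) (seq x n) (seq y n)) ⟩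
    absAt v ((seq x m ℚ.- seq x n) ℚ.+ (seq y m ℚ.- seq y n))
      ≤⟨ absAt-+ v (seq x m ℚ.- seq x n) (seq y m ℚ.- seq y n) ⟩
    absAt v (seq x m ℚ.- seq x n) ℚ.+ absAt v (seq y m ℚ.- seq y n)
      <⟨ ℚ.+-mono-< (closeˣ m n (ℕ.m⊔n≤o⇒m≤o M N ≤m) (ℕ.m⊔n≤o⇒m≤o M N ≤n))
                    (closeʸ m n (ℕ.m⊔n≤o⇒n≤o M N ≤m) (ℕ.m⊔n≤o⇒n≤o M N ≤n)) ⟩
    ½ ℚ.* ε ℚ.+ ½ ℚ.* ε
      ≡⟨ ½+½ ε ⟩
    ε ∎

-_ : ∀ {v} → ℚ[ v ] → ℚ[ v ]
-_ {v} x = completion (λ n → ℚ.- seq x n) cauchy-neg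
  where
  cauchy-neg : IsCauchy v (λ n → ℚ.- seq x n)
  cauchy-neg ε 0<ε with cauchy x ε 0<ε
  ... | N , close = N , λ m n ≤m ≤n → subst (ℚ._< ε)
    (trans (sym (absAt-neg v (seq x m ℚ.- seq x n)))
           (cong (absAt v) (ℚ.neg-distrib-+ (seq x m) (ℚ.- seq x n))))
    (close m n ≤m ≤n)

_-_ : ∀ {v} → ℚ[ v ] → ℚ[ v ] → ℚ[ v ]
x - y = x + (- y)

_*_ : ∀ {v} → ℚ[ v ] → ℚ[ v ] → ℚ[ v ]
_*_ {v} x y = completion (λ n → seq x n ℚ.* seq y n) cauchy-*
  where
  open ℚ.≤-Reasoning
  regroup : ∀ a b c d → a ℚ.* b ℚ.- c ℚ.* d ≡ a ℚ.* (b ℚ.- d) ℚ.+ d ℚ.* (a ℚ.- c)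
  regroup = solve 4 (λ a b c d → a :* b :- c :* d := a :* (b :- d) :+ d :* (a :- c)) refl
    where open +-*-Solver
  B*[δ/B] : ∀ B .{{_ : ℚ.NonZero B}} δ → B ℚ.* (ℚ.1/ B ℚ.* δ) ≡ δ
  B*[δ/B] B δ = trans (sym (ℚ.*-assoc B (ℚ.1/ B) δ))
                  (trans (cong (ℚ._* δ) (ℚ.*-inverseʳ B)) (ℚ.*-identityˡ δ))
  product-< : ∀ {B δ} → 0ℚ ℚ.< B → 0ℚ ℚ.< δ →
              ∃[ η ] 0ℚ ℚ.< η ×
                (∀ a b → absAt v a ℚ.≤ B → absAt v b ℚ.< η → absAt v (a ℚ.* b) ℚ.< δ)
  product-< {B} {δ} 0<B 0<δ =
    ℚ.1/ B ℚ.* δ ,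
    ℚ.positive⁻¹ (ℚ.1/ B ℚ.* δ) {{ℚ.pos*pos⇒pos (ℚ.1/ B) {{ℚ.1/pos⇒pos B}} δ}} ,
    λ a b a≤B b<η → begin-strict
      absAt v (a ℚ.* b)          ≡⟨ absAt-* v a b ⟩
      absAt v a ℚ.* absAt v b    ≤⟨ ℚ.*-monoʳ-≤-nonNeg (absAt v b) {{ℚ.nonNegative (absAt-nonNeg v b)}} a≤B ⟩
      B ℚ.* absAt v b            <⟨ ℚ.*-monoʳ-<-pos B b<η ⟩
      B ℚ.* (ℚ.1/ B ℚ.* δ)       ≡⟨ B*[δ/B] B δ ⟩
      δ                          ∎
    where
    instance
      B>0 = ℚ.positive 0<B
      δ>0 = ℚ.positive 0<δ
      B≢0 = ℚ.pos⇒nonZero B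
  split : ∀ {A B ε} m n →
          absAt v (seq x m ℚ.* (seq y m ℚ.- seq y n)) ℚ.< A →
          absAt v (seq y n ℚ.* (seq x m ℚ.- seq x n)) ℚ.< B →
          A ℚ.+ B ≡ ε →
          absAt v (seq x m ℚ.* seq y m ℚ.- seq x n ℚ.* seq y n) ℚ.< ε
  split {A} {B} {ε} m n <A <B A+B≡ε = begin-strict
    absAt v (seq x m ℚ.* seq y m ℚ.- seq x n ℚ.* seq y n)
      ≡⟨ cong (absAt v) (regroup (seq x m) (seq y m) (seq x n) (seq y n)) ⟩
    absAt v (seq x m ℚ.* (seq y m ℚ.- seq y n) ℚ.+ seq y n ℚ.* (seq x m ℚ.- seq x n))
      ≤⟨ absAt-+ v (seq x m ℚ.* (seq y m ℚ.- seq y n)) (seq y n ℚ.* (seq x m ℚ.- seq x n)) ⟩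
    absAt v (seq x m ℚ.* (seq y m ℚ.- seq y n)) ℚ.+ absAt v (seq y n ℚ.* (seq x m ℚ.- seq x n))
      <⟨ ℚ.+-mono-< <A <B ⟩
    A ℚ.+ B
      ≡⟨ A+B≡ε ⟩
    ε ∎
  cauchy-* : IsCauchy v (λ n → seq x n ℚ.* seq y n)
  cauchy-* ε 0<ε =
    let
      A , 0<A , Nᴬ , ≤A = bounded x
      B , 0<B , Nᴮ , ≤B = bounded y
      α , 0<α , <α = product-< 0<A (0<½* 0<ε)
      β , 0<β , <β = product-< 0<B (0<½* 0<ε)
      M , closeˣ = cauchy x β 0<β
      N , closeʸ = cauchy y α 0<α
      K = Nᴬ ℕ.⊔ Nᴮ
      L = M ℕ.⊔ N
    in K ℕ.⊔ L , λ m n ≤m ≤n →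
    let
      Nᴬ≤m = ℕ.m⊔n≤o⇒m≤o Nᴬ Nᴮ (ℕ.m⊔n≤o⇒m≤o K L ≤m)
      Nᴮ≤n = ℕ.m⊔n≤o⇒n≤o Nᴬ Nᴮ (ℕ.m⊔n≤o⇒m≤o K L ≤n)
      L≤m  = ℕ.m⊔n≤o⇒n≤o K L ≤m
      L≤n  = ℕ.m⊔n≤o⇒n≤o K L ≤n
    in split m n
      (<α (seq x m) (seq y m ℚ.- seq y n) (≤A m Nᴬ≤m)
        (closeʸ m n (ℕ.m⊔n≤o⇒n≤o M N L≤m) (ℕ.m⊔n≤o⇒n≤o M N L≤n)))
      (<β (seq y n) (seq x m ℚ.- seq x n) (≤B n Nᴮ≤n)
        (closeˣ m n (ℕ.m⊔n≤o⇒m≤o M N L≤m) (ℕ.m⊔n≤o⇒m≤o M N L≤n)))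
      (½+½ ε)

_^_ : ∀ {v} → ℚ[ v ] → ℕ → ℚ[ v ]
x ^ zero  = ι 1ℚ
x ^ suc n = x * x ^ n

-- The continuous extension of absAt v to the completion.
∣_∣ : ∀ {v} → ℚ[ v ] → ℝ
∣_∣ {v} x = completion (λ n → absAt v (seq x n)) cauchy-abs
  where
  cauchy-abs : IsCauchy ∞ (λ n → absAt v (seq x n))
  cauchy-abs ε 0<ε with cauchy x ε 0<ε
  ... | N , close = N , λ m n ≤m ≤n →
    ℚ.≤-<-trans (reverse-triangle v (seq x m) (seq x n)) (close m n ≤m ≤n)

-- Order on ℝ, independent of representatives: x < y demands a positive
-- rational gap that eventually separates the sequences.
infix 4 _<_ _≤_

_<_ : ℝ → ℝ → Set
x < y = ∃[ ε ] 0ℚ ℚ.< ε × ∃[ N ] (∀ n → N ℕ.≤ n → seq x n ℚ.+ ε ℚ.≤ seq y n)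

_≤_ : ℝ → ℝ → Set
x ≤ y = ∀ ε → 0ℚ ℚ.< ε → ∃[ N ] (∀ n → N ℕ.≤ n → seq x n ℚ.≤ seq y n ℚ.+ ε)

------------------------------------------------------------------------
-- p-adic integers and adeles

IsPAdicInteger : ∀ p .(pr : Prime p) → ℚ[ fin p pr ] → Set
IsPAdicInteger p pr x = ∣ x ∣ ≤ ι 1ℚ

IsAdele : (∀ v → ℚ[ v ]) → Set
IsAdele x = Σ[ exceptions ∈ List ℕ ]
  (∀ p .(pr : Prime p) → p ∉ exceptions → IsPAdicInteger p pr (x (fin p pr)))

------------------------------------------------------------------------
-- Series and the function F

_ConvergesTo_ : ∀ {v} → (ℕ → ℚ[ v ]) → ℚ[ v ] → Set
s ConvergesTo y = ∀ ε → 0ℚ ℚ.< ε → ∃[ N ] (∀ n → N ℕ.≤ n → ∣ s n - y ∣ < ι ε)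

-- u 1 + u 2 + ⋯ + u N
partialSum : ∀ {v} → (ℕ → ℚ[ v ]) → ℕ → ℚ[ v ]
partialSum u zero    = ι 0ℚ
partialSum u (suc N) = partialSum u N + u (suc N)

-- a (a - 1) ⋯ (a - n + 1)
fallingFactorial : ℚ → ℕ → ℚ
fallingFactorial a zero    = 1ℚ
fallingFactorial a (suc n) = fallingFactorial a n ℚ.* (a ℚ.- (+ n) ℚ./ 1)

binom : ℚ → ℕ → ℚ
binom a n = fallingFactorial a n ℚ.* ((+ 1) ℚ./ (n !)) {{n ℕ.!≢0}}

-- The series F(x) = Σ_{n ≥ 1} (a choose n) xⁿ converges to y in the
-- completion containing x.  Limits are unique up to equality of numbers,
-- so this is the graph of F.
F[_]_≔_ : ∀ {v} → ℚ → ℚ[ v ] → ℚ[ v ] → Set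
F[ a ] x ≔ y = partialSum (λ n → ι (binom a n) * x ^ n) ConvergesTo y

{-# OPTIONS --safe #-}
module Submission where

-- A rational number integral at every prime is an integer, so Pascal's rule makes every
-- binom a n a p-adic integer.  At each place the terms of the series are therefore bounded,
-- uniformly along the Cauchy sequence representing x, by some t with d tₙ + tₙ₊₁ ≤ tₙ
-- eventually (d > 0): at p take tₙ = rⁿ with |x| ≤ r < 1, at ∞ take tₙ = |binom a n| rⁿ and
-- use |binom a (n + 1)| / |binom a n| = |a - n| / (n + 1).  Telescoping bounds the tails,
-- and the sum is represented by the diagonal sequence k ↦ (k-th partial sum at xₖ).  At p
-- this sequence is eventually of absolute value at most 1, by the ultrametric inequality.

open import Defs
import Algebra.Properties.Semiring.Exp as Exp
open import Algebra.Bundles using (CommutativeRing)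
open import Data.Integer.Base as ℤ using (ℤ; +_; -[1+_])
import Data.Integer.Properties as ℤ
open import Data.List.Base using ([]; _∷_)
open import Data.List.Relation.Unary.All using (_∷_)
open import Data.Nat.Base as ℕ using (ℕ; zero; suc; _!)
import Data.Nat.Coprimality as ℕ
open import Data.Nat.Divisibility using (_∣_; ∣-trans; m∣m*n; ∣1⇒≡1)
open import Data.Nat.Primality using (Prime; prime⇒nonZero; prime⇒nonTrivial)
open import Data.Nat.Primality.Factorisation using (factorise)
import Data.Nat.Properties as ℕ
open import Data.Product.Base using (∃-syntax; _×_; _,_)
open import Data.Rational.Base as ℚ using (ℚ; mkℚ; 0ℚ; 1ℚ; ½; ↥_; ↧ₙ_; toℚᵘ)
import Data.Rational.Properties as ℚ
open import Data.Rational.Solver using (module +-*-Solver)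
import Data.Rational.Unnormalised.Base as ℚᵘ
import Data.Rational.Unnormalised.Properties as ℚᵘ
open import Data.Sum.Base using (inj₁; inj₂)
open import Relation.Binary.PropositionalEquality
open import Relation.Nullary using (¬_; yes; no; contradiction)
open import Relation.Nullary.Decidable using (from-no)

open +-*-Solver using (solve; _:+_; _:*_; _:-_; con; _:=_)
open Exp (CommutativeRing.semiring ℚ.+-*-commutativeRing) using () renaming (_^_ to _^ℚ_)

-- Integers and factorials inside the rationals

-- Opaque because unfolding exposes the gcd computation of normalize.
opaque
  fromℤ : ℤ → ℚ
  fromℤ i = i ℚ./ 1

fromℕ : ℕ → ℚ
fromℕ n = fromℤ (+ n)

opaque
  unfolding fromℤ

  fromℤ-0 : fromℤ (+ 0) ≡ 0ℚ
  fromℤ-0 = refl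

  fromℤ-suc : ∀ i → fromℤ (i ℤ.+ + 1) ≡ fromℤ i ℚ.+ 1ℚ
  fromℤ-suc i = ℚ.toℚᵘ-injective (begin
    toℚᵘ (fromℤ (i ℤ.+ + 1))             ≈⟨ toℚᵘ-fromℤ (i ℤ.+ + 1) ⟩
    (i ℤ.+ + 1) ℚᵘ./ 1                   ≈⟨ ℚᵘ.*≡* (cong (λ j → (j ℤ.+ + 1) ℤ.* + 1) (sym (ℤ.*-identityʳ i))) ⟩
    (i ℚᵘ./ 1) ℚᵘ.+ toℚᵘ 1ℚ              ≈⟨ ℚᵘ.+-congˡ (toℚᵘ 1ℚ) (toℚᵘ-fromℤ i) ⟨
    toℚᵘ (fromℤ i) ℚᵘ.+ toℚᵘ 1ℚ          ≈⟨ ℚ.toℚᵘ-homo-+ (fromℤ i) 1ℚ ⟨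
    toℚᵘ (fromℤ i ℚ.+ 1ℚ)                ∎)
    where
    open import Relation.Binary.Reasoning.Setoid ℚᵘ.≃-setoid
    toℚᵘ-fromℤ : ∀ k → toℚᵘ (fromℤ k) ℚᵘ.≃ (k ℚᵘ./ 1)
    toℚᵘ-fromℤ k = ℚ.toℚᵘ-fromℚᵘ (ℚᵘ.mkℚᵘ k 0)

  fromℤ-numerator : ∀ q → ↧ₙ q ≡ 1 → fromℤ (↥ q) ≡ q
  fromℤ-numerator q d≡1 =
    trans (ℚ./-cong {p₁ = ↥ q} {q₂ = ↧ₙ q} refl (sym d≡1)) (ℚ.↥p/↧p≡p q)

  fromℕ-mono-≤ : ∀ {m n} → m ℕ.≤ n → fromℕ m ℚ.≤ fromℕ n
  fromℕ-mono-≤ {m} {n} m≤n = frac-≤ m 1 n 1 (ℕ.*-monoˡ-≤ 1 m≤n)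

  -- The denominator is at least 1, so dividing by it only shrinks the numerator. This crude bound
  -- is all that `archimedean` needs.
  q≤fromℕ∣↥q∣ : ∀ q → q ℚ.≤ fromℕ ℤ.∣ ↥ q ∣
  q≤fromℕ∣↥q∣ q@(mkℚ i c _) = ℚ.toℚᵘ-cancel-≤ (ℚᵘ.≤-respʳ-≃ (ℚᵘ.≃-sym (toℚᵘ-frac ℤ.∣ i ∣ 1))
    (ℚᵘ.*≤* (begin
      i ℤ.* + 1                  ≡⟨ ℤ.*-identityʳ i ⟩
      i                          ≤⟨ i≤∣i∣ i ⟩
      + ℤ.∣ i ∣                  ≤⟨ ℤ.+≤+ (ℕ.m≤m*n ℤ.∣ i ∣ (suc c)) ⟩
      + (ℤ.∣ i ∣ ℕ.* suc c)      ≡⟨ ℤ.pos-* ℤ.∣ i ∣ (suc c) ⟩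
      + ℤ.∣ i ∣ ℤ.* + suc c      ∎)))
    where
    open ℤ.≤-Reasoning
    i≤∣i∣ : ∀ i → i ℤ.≤ + ℤ.∣ i ∣
    i≤∣i∣ (+ n)    = ℤ.≤-refl
    i≤∣i∣ -[1+ n ] = ℤ.-≤+

  fallingFactorial-step : ∀ a n →
    fallingFactorial a (suc n) ≡ fallingFactorial a n ℚ.* (a ℚ.- fromℕ n)
  fallingFactorial-step a n = refl

  1/_! : ℕ → ℚ
  1/ n ! = (+ 1 ℚ./ (n !)) {{n ℕ.!≢0}}

  binom-def : ∀ a n → binom a n ≡ fallingFactorial a n ℚ.* 1/ n !
  binom-def a n = refl

  1/suc!*suc : ∀ n → 1/ suc n ! ℚ.* fromℕ (suc n) ≡ 1/ n !
  1/suc!*suc n = trans (frac-* 1 (suc n !) (suc n) 1)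
    (frac-≡ (1 ℕ.* suc n) (suc n ! ℕ.* 1) 1 (n !) (begin
      1 ℕ.* suc n ℕ.* n !      ≡⟨ cong (ℕ._* n !) (ℕ.*-identityˡ (suc n)) ⟩
      suc n !                  ≡⟨ ℕ.*-identityʳ (suc n !) ⟨
      suc n ! ℕ.* 1            ≡⟨ ℕ.*-identityˡ (suc n ! ℕ.* 1) ⟨
      1 ℕ.* (suc n ! ℕ.* 1)    ∎))
    where
    open ≡-Reasoning
    instance
      n!≢0 : ℕ.NonZero (n !)
      n!≢0 = n ℕ.!≢0
      suc-n!≢0 : ℕ.NonZero (suc n !)
      suc-n!≢0 = suc n ℕ.!≢0
      product≢0 : ℕ.NonZero (suc n ! ℕ.* 1)
      product≢0 = ℕ.m*n≢0 (suc n !) 1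

fromℕ-suc : ∀ n → fromℕ (suc n) ≡ fromℕ n ℚ.+ 1ℚ
fromℕ-suc n = trans (cong fromℕ (ℕ.+-comm 1 n)) (fromℤ-suc (+ n))

1/suc! : ∀ n → 1/ n ! ≡ 1/ suc n ! ℚ.* (fromℕ n ℚ.+ 1ℚ)
1/suc! n = trans (sym (1/suc!*suc n)) (cong (1/ suc n ! ℚ.*_) (fromℕ-suc n))

0≤fromℕ : ∀ n → 0ℚ ℚ.≤ fromℕ n
0≤fromℕ n = subst (ℚ._≤ fromℕ n) fromℤ-0 (fromℕ-mono-≤ ℕ.z≤n)

-- Identities for binomial coefficients

fallingFactorial-suc : ∀ a n →
  fallingFactorial (a ℚ.+ 1ℚ) (suc n) ≡ (a ℚ.+ 1ℚ) ℚ.* fallingFactorial a n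
fallingFactorial-suc a zero = begin
  fallingFactorial (a ℚ.+ 1ℚ) 1             ≡⟨ fallingFactorial-step (a ℚ.+ 1ℚ) 0 ⟩
  1ℚ ℚ.* (a ℚ.+ 1ℚ ℚ.- fromℕ 0)             ≡⟨ cong (λ k → 1ℚ ℚ.* (a ℚ.+ 1ℚ ℚ.- k)) fromℤ-0 ⟩
  1ℚ ℚ.* (a ℚ.+ 1ℚ ℚ.- 0ℚ)                  ≡⟨ solve 1 (λ b → con 1ℚ :* (b :- con 0ℚ) := b :* con 1ℚ) refl (a ℚ.+ 1ℚ) ⟩
  (a ℚ.+ 1ℚ) ℚ.* 1ℚ                         ∎
  where open ≡-Reasoning
fallingFactorial-suc a (suc n) = begin
  fallingFactorial (a ℚ.+ 1ℚ) (suc (suc n))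
    ≡⟨ fallingFactorial-step (a ℚ.+ 1ℚ) (suc n) ⟩
  fallingFactorial (a ℚ.+ 1ℚ) (suc n) ℚ.* (a ℚ.+ 1ℚ ℚ.- fromℕ (suc n))
    ≡⟨ cong₂ (λ f k → f ℚ.* (a ℚ.+ 1ℚ ℚ.- k)) (fallingFactorial-suc a n) (fromℕ-suc n) ⟩
  (a ℚ.+ 1ℚ) ℚ.* f ℚ.* (a ℚ.+ 1ℚ ℚ.- (fromℕ n ℚ.+ 1ℚ))
    -- The last factor, a + 1 - (n + 1), equals a - n, so the factor a + 1 stays in front.
    ≡⟨ solve 3 (λ a f k → (a :+ con 1ℚ) :* f :* (a :+ con 1ℚ :- (k :+ con 1ℚ))
                 := (a :+ con 1ℚ) :* (f :* (a :- k))) refl a f (fromℕ n) ⟩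
  (a ℚ.+ 1ℚ) ℚ.* (f ℚ.* (a ℚ.- fromℕ n))
    ≡⟨ cong ((a ℚ.+ 1ℚ) ℚ.*_) (fallingFactorial-step a n) ⟨
  (a ℚ.+ 1ℚ) ℚ.* fallingFactorial a (suc n) ∎
  where
  open ≡-Reasoning
  f = fallingFactorial a n

binom-suc : ∀ a n → binom a (suc n) ≡ fallingFactorial a n ℚ.* (a ℚ.- fromℕ n) ℚ.* 1/ suc n !
binom-suc a n = trans (binom-def a (suc n)) (cong (ℚ._* 1/ suc n !) (fallingFactorial-step a n))

binom-via-1/suc! : ∀ a n → binom a n ≡ fallingFactorial a n ℚ.* (1/ suc n ! ℚ.* (fromℕ n ℚ.+ 1ℚ))
binom-via-1/suc! a n = trans (binom-def a n) (cong (fallingFactorial a n ℚ.*_) (1/suc! n))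

-- The recursion behind the ratio test at `∞`, cleared of the denominator n + 1.
binom-ratio : ∀ a n → binom a (suc n) ℚ.* (fromℕ n ℚ.+ 1ℚ) ≡ binom a n ℚ.* (a ℚ.- fromℕ n)
binom-ratio a n = begin
  binom a (suc n) ℚ.* (k ℚ.+ 1ℚ)              ≡⟨ cong (ℚ._* (k ℚ.+ 1ℚ)) (binom-suc a n) ⟩
  f ℚ.* (a ℚ.- k) ℚ.* i ℚ.* (k ℚ.+ 1ℚ)        ≡⟨ solve 4 (λ f g i j → f :* g :* i :* j := f :* (i :* j) :* g) refl
                                                   f (a ℚ.- k) i (k ℚ.+ 1ℚ) ⟩
  f ℚ.* (i ℚ.* (k ℚ.+ 1ℚ)) ℚ.* (a ℚ.- k)      ≡⟨ cong (ℚ._* (a ℚ.- k)) (binom-via-1/suc! a n) ⟨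
  binom a n ℚ.* (a ℚ.- k)                     ∎
  where
  open ≡-Reasoning
  f = fallingFactorial a n
  k = fromℕ n
  i = 1/ suc n !

-- Over the common denominator (n + 1)! the factor `f` is shared, and a + 1 = (a - n) + (n + 1).
pascal : ∀ a n → binom (a ℚ.+ 1ℚ) (suc n) ≡ binom a (suc n) ℚ.+ binom a n
pascal a n = begin
  binom (a ℚ.+ 1ℚ) (suc n)                    ≡⟨ binom-def (a ℚ.+ 1ℚ) (suc n) ⟩
  fallingFactorial (a ℚ.+ 1ℚ) (suc n) ℚ.* i   ≡⟨ cong (ℚ._* i) (fallingFactorial-suc a n) ⟩
  (a ℚ.+ 1ℚ) ℚ.* f ℚ.* i
    ≡⟨ solve 4 (λ a f i k → (a :+ con 1ℚ) :* f :* i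
                 := f :* (a :- k) :* i :+ f :* (i :* (k :+ con 1ℚ))) refl a f i k ⟩
  f ℚ.* (a ℚ.- k) ℚ.* i ℚ.+ f ℚ.* (i ℚ.* (k ℚ.+ 1ℚ))
    ≡⟨ cong₂ ℚ._+_ (binom-suc a n) (binom-via-1/suc! a n) ⟨
  binom a (suc n) ℚ.+ binom a n ∎
  where
  open ≡-Reasoning
  f = fallingFactorial a n
  k = fromℕ n
  i = 1/ suc n !

binom-0-suc : ∀ n → binom 0ℚ (suc n) ≡ 0ℚ
binom-0-suc n = begin
  binom 0ℚ (suc n)                            ≡⟨ binom-def 0ℚ (suc n) ⟩
  -- Reading 0 as -1 + 1 brings a factor 0 to the front.
  fallingFactorial 0ℚ (suc n) ℚ.* 1/ suc n !  ≡⟨ cong (ℚ._* 1/ suc n !) (fallingFactorial-suc (ℚ.- 1ℚ) n) ⟩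
  0ℚ ℚ.* f ℚ.* 1/ suc n !                     ≡⟨ solve 2 (λ f i → con 0ℚ :* f :* i := con 0ℚ) refl f (1/ suc n !) ⟩
  0ℚ                                          ∎
  where
  open ≡-Reasoning
  f = fallingFactorial (ℚ.- 1ℚ) n

module _ {P : ℚ → Set} (P-1 : P 1ℚ) (P-+ : ∀ {q r} → P q → P r → P (q ℚ.+ r))
         (P-neg : ∀ {q} → P q → P (ℚ.- q)) where

  -- Pascal's rule involves only addition, so `P` may be any additive subgroup containing 1. The
  -- upper entry is walked up and down from 0.
  binom-integer∈ : ∀ i n → P (binom (fromℤ i) n)
  binom-integer∈ = λ where
      (+ n)    → natural n
      -[1+ n ] → negative n
    where
    up : ∀ {a b} → b ≡ a ℚ.+ 1ℚ → (∀ n → P (binom a n)) → ∀ n → P (binom b n)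
    up refl Pa zero    = P-1
    up {a} refl Pa (suc n) = subst P (sym (pascal a n)) (P-+ (Pa (suc n)) (Pa n))

    down : ∀ {a b} → b ≡ a ℚ.+ 1ℚ → (∀ n → P (binom b n)) → ∀ n → P (binom a n)
    down refl Pb zero = P-1
    -- Solved for `binom a (suc n)`, Pascal's rule refers back to `binom a n`, so the descent in `a`
    -- needs an inner induction on `n`.
    down {a} refl Pb (suc n) = subst P
      (trans (cong (ℚ._- binom a n) (pascal a n))
             (solve 2 (λ x y → x :+ y :- y := x) refl (binom a (suc n)) (binom a n)))
      (P-+ (Pb (suc n)) (P-neg (down refl Pb n)))

    P-0 : P 0ℚ
    P-0 = subst P (ℚ.+-inverseʳ 1ℚ) (P-+ P-1 (P-neg P-1))

    natural : ∀ m n → P (binom (fromℕ m) n)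
    natural zero    zero    = P-1
    natural zero    (suc n) =
      subst P (sym (trans (cong (λ b → binom b (suc n)) fromℤ-0) (binom-0-suc n))) P-0
    natural (suc m) = up (fromℕ-suc m) (natural m)

    negative : ∀ m n → P (binom (fromℤ -[1+ m ]) n)
    -- Here -1 + 1 evaluates to `+ 0`, so the descent starts from the natural number 0.
    negative zero    = down (fromℤ-suc -[1+ 0 ]) (natural 0)
    negative (suc m) = down (fromℤ-suc -[1+ suc m ]) (negative m)

-- Integrality at the primes

absAt-1≤1 : ∀ v → absAt v 1ℚ ℚ.≤ 1ℚ
absAt-1≤1 ∞ = ℚ.≤-refl
absAt-1≤1 (fin p pr) = ℚ.≤-reflexive (trans (PAdic.abs-≢0 p pr′ {1ℚ} λ ())
  (frac-≡ (p ℕ.^ ord p 1) (p ℕ.^ ord p 1) 1 1 {{nz}} (ℕ.*-comm (p ℕ.^ ord p 1) 1)))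
  where
  pr′ = toPrime p pr
  nz = ℕ.m^n≢0 p (ord p 1) {{prime⇒nonZero pr′}}

module _ (p : ℕ) .(pr : Prime p) where

  integral-+ : ∀ {q r} → absAt (fin p pr) q ℚ.≤ 1ℚ → absAt (fin p pr) r ℚ.≤ 1ℚ →
               absAt (fin p pr) (q ℚ.+ r) ℚ.≤ 1ℚ
  integral-+ {q} {r} q≤1 r≤1 with PAdic.ultrametric p (toPrime p pr) q r
  ... | inj₁ le = ℚ.≤-trans le q≤1
  ... | inj₂ le = ℚ.≤-trans le r≤1

  integral-neg : ∀ {q} → absAt (fin p pr) q ℚ.≤ 1ℚ → absAt (fin p pr) (ℚ.- q) ℚ.≤ 1ℚ
  integral-neg {q} = subst (ℚ._≤ 1ℚ) (sym (absAt-neg (fin p pr) q))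

  -- In lowest terms `p` cannot also divide the numerator: its order there is 0, and in the
  -- denominator it is at least 1.
  absAt-denominator : ∀ q → p ∣ ↧ₙ q → frac p 1 ℚ.≤ absAt (fin p pr) q
  absAt-denominator q@(mkℚ _ _ coprime) p∣d = subst (frac p 1 ℚ.≤_) (sym (PAdic.abs-≢0 p pr′ q≢0))
    (frac-≤ p 1 (p ℕ.^ ord p (↧ₙ q)) (p ℕ.^ ord p n) {{_}} {{ℕ.m^n≢0 p (ord p n)}} (begin
      p ℕ.* p ℕ.^ ord p n          ≡⟨ cong (λ k → p ℕ.* p ℕ.^ k) ord≡0 ⟩
      p ℕ.* 1                      ≤⟨ ℕ.^-monoʳ-≤ p (ord-max p (↧ₙ q) {1} p^1∣d) ⟩
      p ℕ.^ ord p (↧ₙ q)           ≡⟨ ℕ.*-identityʳ _ ⟨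
      p ℕ.^ ord p (↧ₙ q) ℕ.* 1     ∎))
    where
    open ℕ.≤-Reasoning
    pr′ = toPrime p pr
    n = ℤ.∣ ↥ q ∣
    instance
      p≢0 = prime⇒nonZero pr′
      p>1 = prime⇒nonTrivial pr′
    p^1∣d : p ℕ.^ 1 ∣ ↧ₙ q
    p^1∣d = subst (_∣ ↧ₙ q) (sym (ℕ.*-identityʳ p)) p∣d
    p∤n : ¬ p ∣ n
    p∤n p∣n = ℕ.nonTrivial⇒≢1 (ℕ.recompute coprime (p∣n , p∣d))
    q≢0 : q ≢ 0ℚ
    -- The reduced form of 0 has denominator 1, which `p` does not divide.
    q≢0 eq = ℕ.nonTrivial⇒≢1 (∣1⇒≡1 (subst (λ r → p ∣ ↧ₙ r) eq p∣d))
    ord≡0 : ord p n ≡ 0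
    ord≡0 with ord p n | p^ord∣n p n
    ... | zero  | _ = refl
    ... | suc k | d = contradiction (∣-trans (m∣m*n (p ℕ.^ k)) d) p∤n

  denominator⇒¬integral : ∀ a → p ∣ ↧ₙ a → ¬ IsPAdicInteger p pr (ι a)
  -- `≤` on `ℝ` allows a tolerance; taking ½ leaves 2 ≤ p ≤ |a| ≤ 3/2, which is absurd.
  denominator⇒¬integral a p∣d a∈ℤₚ with a∈ℤₚ ½ (ℚ.positive⁻¹ ½)
  ... | N , ≤3/2 = from-no (frac 2 1 ℚ.≤? 1ℚ ℚ.+ ½) (begin
    frac 2 1               ≤⟨ frac-≤ 2 1 p 1 (ℕ.*-monoˡ-≤ 1 p>1) ⟩
    frac p 1               ≤⟨ absAt-denominator a p∣d ⟩
    absAt (fin p pr) a     ≤⟨ ≤3/2 N ℕ.≤-refl ⟩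
    1ℚ ℚ.+ ½               ∎)
    where
    open ℚ.≤-Reasoning
    p>1 : 1 ℕ.< p
    p>1 = ℕ.nonTrivial⇒n>1 p {{prime⇒nonTrivial (toPrime p pr)}}

primeDivisor : ∀ n .{{_ : ℕ.NonZero n}} → n ≢ 1 → ∃[ p ] Prime p × p ∣ n
primeDivisor n n≢1 with factorise n
... | record { factors = []     ; isFactorisation = eq } = contradiction eq n≢1
... | record { factors = p ∷ ps ; isFactorisation = eq ; factorsPrime = pr ∷ _ } =
  p , pr , subst (p ∣_) (sym eq) (m∣m*n _)

-- A reduced denominator other than 1 has a prime divisor, and `a` fails to be integral there.
everywhereIntegral⇒integer : ∀ a → (∀ p .(pr : Prime p) → IsPAdicInteger p pr (ι a)) →
                             fromℤ (↥ a) ≡ a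
everywhereIntegral⇒integer a a∈ℤₚ with ↧ₙ a ℕ.≟ 1
... | yes d≡1 = fromℤ-numerator a d≡1
... | no  d≢1 with primeDivisor (↧ₙ a) d≢1
...   | p , pr , p∣d = contradiction (a∈ℤₚ p pr) (denominator⇒¬integral p pr a p∣d)

-- By the ultrametric inequality, the rationals of p-adic absolute value at most 1 form an additive
-- subgroup, and it contains 1.
binom-integral : ∀ a → (∀ p .(pr : Prime p) → IsPAdicInteger p pr (ι a)) →
                 ∀ p .(pr : Prime p) n → absAt (fin p pr) (binom a n) ℚ.≤ 1ℚ
binom-integral a a∈ℤₚ p pr n =
  subst (λ b → absAt (fin p pr) (binom b n) ℚ.≤ 1ℚ) (everywhereIntegral⇒integer a a∈ℤₚ)
    (binom-integer∈ {P = λ q → absAt (fin p pr) q ℚ.≤ 1ℚ} (absAt-1≤1 (fin p pr))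
      (λ {q} {r} → integral-+ p pr {q} {r}) (λ {q} → integral-neg p pr {q}) (↥ a) n)

-- Dominated series in a completion

opaque
  archimedean : ∀ d → 0ℚ ℚ.< d → ∀ q → ∃[ n ] q ℚ.≤ d ℚ.* fromℕ n
  archimedean d 0<d q = n , (begin
    q                          ≡⟨ trans (cong (ℚ._* q) (ℚ.*-inverseʳ d)) (ℚ.*-identityˡ q) ⟨
    d ℚ.* ℚ.1/ d ℚ.* q         ≡⟨ ℚ.*-assoc d (ℚ.1/ d) q ⟩
    d ℚ.* (ℚ.1/ d ℚ.* q)       ≤⟨ ℚ.*-monoˡ-≤-nonNeg d (q≤fromℕ∣↥q∣ (ℚ.1/ d ℚ.* q)) ⟩
    d ℚ.* fromℕ n              ∎)
    where
    open ℚ.≤-Reasoning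
    instance
      d>0 : ℚ.Positive d
      d>0 = ℚ.positive 0<d
      d≥0 : ℚ.NonNegative d
      d≥0 = ℚ.pos⇒nonNeg d
      d≢0 : ℚ.NonZero d
      d≢0 = ℚ.pos⇒nonZero d
    n : ℕ
    n = ℤ.∣ ↥ (ℚ.1/ d ℚ.* q) ∣

0≤* : ∀ {p q} → 0ℚ ℚ.≤ p → 0ℚ ℚ.≤ q → 0ℚ ℚ.≤ p ℚ.* q
0≤* {p} {q} 0≤p 0≤q =
  ℚ.nonNegative⁻¹ _ {{ℚ.nonNeg*nonNeg⇒nonNeg p {{ℚ.nonNegative 0≤p}} q {{ℚ.nonNegative 0≤q}}}}

-- `decay` says t (n + 1) ≤ (1 - d) t n; keeping the loss d t n as a summand lets it telescope.
module _ (t : ℕ → ℚ) (0≤t : ∀ n → 0ℚ ℚ.≤ t n) {d} (0<d : 0ℚ ℚ.< d) (N : ℕ)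
         (decay : ∀ n → N ℕ.≤ n → d ℚ.* t n ℚ.+ t (suc n) ℚ.≤ t n) where

  decay⇒decreasing : ∀ n → N ℕ.≤ n → t (suc n) ℚ.≤ t n
  decay⇒decreasing n N≤n = ℚ.≤-trans
    (subst (ℚ._≤ d ℚ.* t n ℚ.+ t (suc n)) (ℚ.+-identityˡ (t (suc n)))
      (ℚ.+-monoˡ-≤ (t (suc n)) (0≤* (ℚ.<⇒≤ 0<d) (0≤t n))))
    (decay n N≤n)

  -- The rate 1/k suffices for vanishing and, unlike the geometric one, involves no powers.
  decay⇒harmonic : ∀ k → d ℚ.* fromℕ k ℚ.* t (k ℕ.+ N) ℚ.+ t (k ℕ.+ N) ℚ.≤ t N
  decay⇒harmonic zero = ℚ.≤-reflexive (trans (cong (λ i → d ℚ.* i ℚ.* t N ℚ.+ t N) fromℤ-0)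
    (solve 2 (λ d t → d :* con 0ℚ :* t :+ t := t) refl d (t N)))
  decay⇒harmonic (suc k) = begin
    d ℚ.* fromℕ (suc k) ℚ.* t′ ℚ.+ t′
      ≡⟨ cong (λ i → d ℚ.* i ℚ.* t′ ℚ.+ t′) (fromℕ-suc k) ⟩
    d ℚ.* (fromℕ k ℚ.+ 1ℚ) ℚ.* t′ ℚ.+ t′
      -- Only the `t′` in the product is enlarged to `tₖ`; the lone `t′` is kept so that `decay` can
      -- absorb it together with d tₖ.
      ≤⟨ ℚ.+-monoˡ-≤ t′ (ℚ.*-monoˡ-≤-nonNeg (d ℚ.* (fromℕ k ℚ.+ 1ℚ)) {{ℚ.nonNegative 0≤coeff}}
           (decay⇒decreasing (k ℕ.+ N) (ℕ.m≤n+m N k))) ⟩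
    d ℚ.* (fromℕ k ℚ.+ 1ℚ) ℚ.* tₖ ℚ.+ t′
      ≡⟨ solve 4 (λ d k t t′ → d :* (k :+ con 1ℚ) :* t :+ t′ := d :* k :* t :+ (d :* t :+ t′)) refl
           d (fromℕ k) tₖ t′ ⟩
    d ℚ.* fromℕ k ℚ.* tₖ ℚ.+ (d ℚ.* tₖ ℚ.+ t′)
      ≤⟨ ℚ.+-monoʳ-≤ (d ℚ.* fromℕ k ℚ.* tₖ) (decay (k ℕ.+ N) (ℕ.m≤n+m N k)) ⟩
    d ℚ.* fromℕ k ℚ.* tₖ ℚ.+ tₖ
      ≤⟨ decay⇒harmonic k ⟩
    t N ∎
    where
    open ℚ.≤-Reasoning
    tₖ = t (k ℕ.+ N)
    t′ = t (suc k ℕ.+ N)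
    0≤coeff : 0ℚ ℚ.≤ d ℚ.* (fromℕ k ℚ.+ 1ℚ)
    0≤coeff = 0≤* (ℚ.<⇒≤ 0<d) (subst (0ℚ ℚ.≤_) (fromℕ-suc k) (0≤fromℕ (suc k)))

  opaque
    decay⇒vanishing : ∀ δ → 0ℚ ℚ.< δ → ∃[ M ] N ℕ.≤ M × t M ℚ.< δ
    decay⇒vanishing δ 0<δ with archimedean (d ℚ.* δ) 0<dδ (t N)
      where
      0<dδ : 0ℚ ℚ.< d ℚ.* δ
      0<dδ = ℚ.positive⁻¹ _ {{ℚ.pos*pos⇒pos d {{ℚ.positive 0<d}} δ {{ℚ.positive 0<δ}}}}
    -- If δ ≤ t (k + N), the harmonic bound gives dkδ + δ ≤ t N ≤ dδk, contradicting δ > 0.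
    ... | k , tN≤dδk = k ℕ.+ N , ℕ.m≤n+m N k , ℚ.≰⇒> (λ δ≤t → ℚ.<-irrefl refl (begin-strict
      t N
        ≡⟨ ℚ.+-identityʳ (t N) ⟨
      t N ℚ.+ 0ℚ
        <⟨ ℚ.+-mono-≤-< tN≤dδk 0<δ ⟩
      d ℚ.* δ ℚ.* fromℕ k ℚ.+ δ
        ≡⟨ solve 3 (λ d δ k → d :* δ :* k :+ δ := d :* k :* δ :+ δ) refl d δ (fromℕ k) ⟩
      d ℚ.* fromℕ k ℚ.* δ ℚ.+ δ
        ≤⟨ ℚ.+-mono-≤ (ℚ.*-monoˡ-≤-nonNeg (d ℚ.* fromℕ k)
             {{ℚ.nonNegative (0≤* (ℚ.<⇒≤ 0<d) (0≤fromℕ k))}} δ≤t) δ≤t ⟩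
      d ℚ.* fromℕ k ℚ.* t (k ℕ.+ N) ℚ.+ t (k ℕ.+ N)
        ≤⟨ decay⇒harmonic k ⟩
      t N ∎))
      where open ℚ.≤-Reasoning

opaque
  halve : ∀ ε → 0ℚ ℚ.< ε → ∃[ h ] 0ℚ ℚ.< h × h ℚ.+ h ≡ ε
  halve ε 0<ε = ½ ℚ.* ε , ℚ.*-monoʳ-<-pos ½ 0<ε ,
    solve 1 (λ ε → con ½ :* ε :+ con ½ :* ε := ε) refl ε

absAt-via : ∀ v q r z → absAt v (q ℚ.- r) ℚ.≤ absAt v (q ℚ.- z) ℚ.+ absAt v (r ℚ.- z)
absAt-via v q r z = begin
  absAt v (q ℚ.- r)                         ≡⟨ cong (absAt v) (split q r z) ⟩
  absAt v ((q ℚ.- z) ℚ.+ (z ℚ.- r))         ≤⟨ absAt-+ v (q ℚ.- z) (z ℚ.- r) ⟩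
  absAt v (q ℚ.- z) ℚ.+ absAt v (z ℚ.- r)   ≡⟨ cong (absAt v (q ℚ.- z) ℚ.+_) (absAt-swap v z r) ⟩
  absAt v (q ℚ.- z) ℚ.+ absAt v (r ℚ.- z)   ∎
  where
  open ℚ.≤-Reasoning
  split : ∀ q r z → q ℚ.- r ≡ (q ℚ.- z) ℚ.+ (z ℚ.- r)
  split = solve 3 (λ q r z → q :- r := (q :- z) :+ (z :- r)) refl

-- `K` does not depend on `n`. This uniformity lets the length of the partial sum and the index of
-- the approximation grow together along the diagonal.
record Majorant {v} (u : ℕ → ℚ[ v ]) : Set where
  field
    K     : ℕ
    t     : ℕ → ℚ
    bound : ∀ n k → K ℕ.≤ k → absAt v (seq (u n) k) ℚ.≤ t n
    {d}   : ℚ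
    0<d   : 0ℚ ℚ.< d
    N     : ℕ
    decay : ∀ n → N ℕ.≤ n → d ℚ.* t n ℚ.+ t (suc n) ℚ.≤ t n

module Summation {v} {u : ℕ → ℚ[ v ]} (majorant : Majorant u) where
  open Majorant majorant

  private
    s : ℕ → ℕ → ℚ
    s n k = seq (partialSum u n) k

    instance
      d>0 = ℚ.positive 0<d
      d≥0 = ℚ.pos⇒nonNeg d

  0≤t : ∀ n → 0ℚ ℚ.≤ t n
  0≤t n = ℚ.≤-trans (absAt-nonNeg v (seq (u n) K)) (bound n K ℕ.≤-refl)

  -- Telescoping of d |u n| ≤ d t n ≤ t n - t (n + 1) over n from M + 1 to M + j. The last t stays
  -- on the left so that the induction on `j` closes.
  tail-bound : ∀ M → N ℕ.≤ M → ∀ k → K ℕ.≤ k → ∀ j →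
         d ℚ.* absAt v (s (j ℕ.+ M) k ℚ.- s M k) ℚ.+ t (suc (j ℕ.+ M)) ℚ.≤ t (suc M)
  tail-bound M N≤M k ≤k zero = ℚ.≤-reflexive (begin
    d ℚ.* absAt v (s M k ℚ.- s M k) ℚ.+ t (suc M)   ≡⟨ cong (λ z → d ℚ.* absAt v z ℚ.+ t (suc M)) (ℚ.+-inverseʳ (s M k)) ⟩
    d ℚ.* absAt v 0ℚ ℚ.+ t (suc M)                  ≡⟨ cong (λ z → d ℚ.* z ℚ.+ t (suc M)) (absAt-0 v) ⟩
    d ℚ.* 0ℚ ℚ.+ t (suc M)                          ≡⟨ solve 2 (λ d t → d :* con 0ℚ :+ t := t) refl d (t (suc M)) ⟩
    t (suc M)                                       ∎)
    where open ≡-Reasoning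
  tail-bound M N≤M k ≤k (suc j) = begin
    d ℚ.* absAt v (sⱼ ℚ.+ uⱼ ℚ.- s M k) ℚ.+ t′
      ≡⟨ cong (λ z → d ℚ.* absAt v z ℚ.+ t′)
           (solve 3 (λ s u m → s :+ u :- m := (s :- m) :+ u) refl sⱼ uⱼ (s M k)) ⟩
    d ℚ.* absAt v ((sⱼ ℚ.- s M k) ℚ.+ uⱼ) ℚ.+ t′
      ≤⟨ ℚ.+-monoˡ-≤ t′ (ℚ.*-monoˡ-≤-nonNeg d (ℚ.≤-trans (absAt-+ v (sⱼ ℚ.- s M k) uⱼ)
           (ℚ.+-monoʳ-≤ A (bound n k ≤k)))) ⟩
    d ℚ.* (A ℚ.+ t n) ℚ.+ t′
      ≡⟨ solve 4 (λ d a t t′ → d :* (a :+ t) :+ t′ := d :* a :+ (d :* t :+ t′)) refl d A (t n) t′ ⟩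
    d ℚ.* A ℚ.+ (d ℚ.* t n ℚ.+ t′)
      ≤⟨ ℚ.+-monoʳ-≤ (d ℚ.* A) (decay n (ℕ.m≤n⇒m≤1+n (ℕ.≤-trans N≤M (ℕ.m≤n+m M j)))) ⟩
    d ℚ.* A ℚ.+ t n
      ≤⟨ tail-bound M N≤M k ≤k j ⟩
    t (suc M) ∎
    where
    open ℚ.≤-Reasoning
    n = suc (j ℕ.+ M)
    sⱼ = s (j ℕ.+ M) k
    uⱼ = seq (u n) k
    t′ = t (suc n)
    A = absAt v (sⱼ ℚ.- s M k)

  opaque
    uniformTail : ∀ ε → 0ℚ ℚ.< ε →
                  ∃[ M ] ∀ m k → M ℕ.≤ m → K ℕ.≤ k → absAt v (s m k ℚ.- s M k) ℚ.< ε
    uniformTail ε 0<ε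
      -- The tail after `M` starts at index M + 1, hence the shift of `t`; `tail-bound` controls `d`
      -- times the tail, hence the threshold dε.
      with decay⇒vanishing (λ n → t (suc n)) (λ n → 0≤t (suc n)) 0<d N
             (λ n N≤n → decay (suc n) (ℕ.m≤n⇒m≤1+n N≤n)) (d ℚ.* ε)
             (ℚ.positive⁻¹ _ {{ℚ.pos*pos⇒pos d ε {{ℚ.positive 0<ε}}}})
    ... | M , N≤M , t<dε = M , λ m k M≤m ≤k → ℚ.*-cancelˡ-<-nonNeg d (begin-strict
      d ℚ.* absAt v (s m k ℚ.- s M k)
        ≡⟨ ℚ.+-identityʳ _ ⟨
      d ℚ.* absAt v (s m k ℚ.- s M k) ℚ.+ 0ℚ
        ≤⟨ ℚ.+-monoʳ-≤ (d ℚ.* absAt v (s m k ℚ.- s M k)) (0≤t (suc m)) ⟩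
      d ℚ.* absAt v (s m k ℚ.- s M k) ℚ.+ t (suc m)
        ≤⟨ subst (λ i → d ℚ.* absAt v (s i k ℚ.- s M k) ℚ.+ t (suc i) ℚ.≤ t (suc M))
             (ℕ.m∸n+n≡m M≤m) (tail-bound M N≤M k ≤k (m ℕ.∸ M)) ⟩
      t (suc M)
        <⟨ t<dε ⟩
      d ℚ.* ε ∎)
      where open ℚ.≤-Reasoning

  total : ℚ[ v ]
  total = completion (λ k → s k k) diagonal-cauchy
    where
    -- The path runs from `s m m` through `s M m` and `s M n` to `s n n`. The outer steps are tails,
    -- the middle one is the Cauchy property of the fixed partial sum of length `M`.
    diagonal-cauchy : IsCauchy v (λ k → s k k)
    diagonal-cauchy ε 0<ε with halve ε 0<ε
    ... | h , 0<h , h+h≡ε with halve h 0<h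
    ... | g , 0<g , g+g≡h with uniformTail g 0<g
    ... | M , tail with cauchy (partialSum u M) h 0<h
    ... | L , close = (M ℕ.⊔ K) ℕ.⊔ L , λ m n ≤m ≤n → begin-strict
      absAt v (s m m ℚ.- s n n)
        ≤⟨ absAt-via v (s m m) (s n n) (s M n) ⟩
      absAt v (s m m ℚ.- s M n) ℚ.+ absAt v (s n n ℚ.- s M n)
        ≤⟨ ℚ.+-monoˡ-≤ (absAt v (s n n ℚ.- s M n)) (absAt-via v (s m m) (s M n) (s M m)) ⟩
      (absAt v (s m m ℚ.- s M m) ℚ.+ absAt v (s M n ℚ.- s M m)) ℚ.+ absAt v (s n n ℚ.- s M n)
        <⟨ ℚ.+-mono-< (ℚ.+-mono-< (near m ≤m)
             (close n m (ℕ.m⊔n≤o⇒n≤o (M ℕ.⊔ K) L ≤n) (ℕ.m⊔n≤o⇒n≤o (M ℕ.⊔ K) L ≤m))) (near n ≤n) ⟩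
      (g ℚ.+ h) ℚ.+ g
        ≡⟨ solve 2 (λ g h → (g :+ h) :+ g := (g :+ g) :+ h) refl g h ⟩
      (g ℚ.+ g) ℚ.+ h
        ≡⟨ trans (cong (ℚ._+ h) g+g≡h) h+h≡ε ⟩
      ε ∎
      where
      open ℚ.≤-Reasoning
      near : ∀ k → (M ℕ.⊔ K) ℕ.⊔ L ℕ.≤ k → absAt v (s k k ℚ.- s M k) ℚ.< g
      near k ≤k = tail k k (ℕ.m⊔n≤o⇒m≤o M K M⊔K≤k) (ℕ.m⊔n≤o⇒n≤o M K M⊔K≤k)
        where M⊔K≤k = ℕ.m⊔n≤o⇒m≤o (M ℕ.⊔ K) L ≤k

  partialSum-converges : partialSum u ConvergesTo total
  partialSum-converges ε 0<ε with halve ε 0<ε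
  ... | h , 0<h , h+h≡ε with halve h 0<h
  ... | g , 0<g , g+g≡h with uniformTail g 0<g
  -- One half `h` of ε is the rational gap that `<` demands; the other covers two tails beyond `M`,
  -- since k ≥ n ≥ M.
  ... | M , tail = M , λ n M≤n → h , 0<h , n ℕ.⊔ K , λ k ≤k →
    let
      n≤k = ℕ.m⊔n≤o⇒m≤o n K ≤k
      K≤k = ℕ.m⊔n≤o⇒n≤o n K ≤k
    in begin
      absAt v (s n k ℚ.- s k k) ℚ.+ h
        ≤⟨ ℚ.+-monoˡ-≤ h (absAt-via v (s n k) (s k k) (s M k)) ⟩
      absAt v (s n k ℚ.- s M k) ℚ.+ absAt v (s k k ℚ.- s M k) ℚ.+ h
        ≤⟨ ℚ.+-monoˡ-≤ h (ℚ.<⇒≤ (ℚ.+-mono-< (tail n k M≤n K≤k) (tail k k (ℕ.≤-trans M≤n n≤k) K≤k))) ⟩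
      g ℚ.+ g ℚ.+ h
        ≡⟨ trans (cong (ℚ._+ h) g+g≡h) h+h≡ε ⟩
      ε ∎
    where open ℚ.≤-Reasoning

-- The binomial series

absAt-^ : ∀ v (x : ℚ[ v ]) {r k} → absAt v (seq x k) ℚ.≤ r →
          ∀ n → absAt v (seq (x ^ n) k) ℚ.≤ r ^ℚ n
absAt-^ v x x≤r zero = absAt-1≤1 v
absAt-^ v x {r} {k} x≤r (suc n) = begin
  absAt v (seq x k ℚ.* xⁿ)              ≡⟨ absAt-* v (seq x k) xⁿ ⟩
  absAt v (seq x k) ℚ.* absAt v xⁿ      ≤⟨ ℚ.*-monoˡ-≤-nonNeg (absAt v (seq x k)) ih ⟩
  absAt v (seq x k) ℚ.* r ^ℚ n          ≤⟨ ℚ.*-monoʳ-≤-nonNeg (r ^ℚ n) x≤r ⟩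
  r ℚ.* r ^ℚ n                          ∎
  where
  open ℚ.≤-Reasoning
  xⁿ = seq (x ^ n) k
  ih = absAt-^ v x x≤r n
  instance
    _ = ℚ.nonNegative (absAt-nonNeg v (seq x k))
    _ = ℚ.nonNegative (ℚ.≤-trans (absAt-nonNeg v xⁿ) ih)

absAt-monomial : ∀ v (x : ℚ[ v ]) {r k} → absAt v (seq x k) ℚ.≤ r → ∀ b n →
                 absAt v (b ℚ.* seq (x ^ n) k) ℚ.≤ absAt v b ℚ.* r ^ℚ n
absAt-monomial v x {r} {k} x≤r b n = ℚ.≤-trans (ℚ.≤-reflexive (absAt-* v b (seq (x ^ n) k)))
  (ℚ.*-monoˡ-≤-nonNeg (absAt v b) {{ℚ.nonNegative (absAt-nonNeg v b)}} (absAt-^ v x x≤r n))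

0≤^ : ∀ {r} → 0ℚ ℚ.≤ r → ∀ n → 0ℚ ℚ.≤ r ^ℚ n
0≤^ 0≤r zero    = ℚ.nonNegative⁻¹ 1ℚ
0≤^ 0≤r (suc n) = 0≤* 0≤r (0≤^ 0≤r n)

+≤1⇒≤1- : ∀ {q ε} → q ℚ.+ ε ℚ.≤ 1ℚ → q ℚ.≤ 1ℚ ℚ.- ε
+≤1⇒≤1- {q} {ε} le =
  subst (ℚ._≤ 1ℚ ℚ.- ε) (solve 2 (λ q ε → q :+ ε :- ε := q) refl q ε) (ℚ.+-monoˡ-≤ (ℚ.- ε) le)

-- The series at a prime

module _ (p : ℕ) .(pr : Prime p) (b : ℕ → ℚ) (b≤1 : ∀ n → absAt (fin p pr) (b n) ℚ.≤ 1ℚ)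
         (x : ℚ[ fin p pr ]) where

  -- Coefficients of absolute value at most 1 leave only the powers of `x` to dominate, and r = 1 -
  -- ε bounds `x`, with ε the gap below 1.
  p-adicMajorant : ∣ x ∣ < ι 1ℚ → Majorant (λ n → ι (b n) * x ^ n)
  p-adicMajorant (ε , 0<ε , K , x+ε≤1) = record
    { K     = K
    ; t     = r ^ℚ_
    ; bound = λ n k K≤k → ℚ.≤-trans (absAt-monomial (fin p pr) x (x≤r k K≤k) (b n) n)
        (subst (absAt (fin p pr) (b n) ℚ.* r ^ℚ n ℚ.≤_) (ℚ.*-identityˡ (r ^ℚ n))
          (ℚ.*-monoʳ-≤-nonNeg (r ^ℚ n) {{ℚ.nonNegative (0≤^ 0≤r n)}} (b≤1 n)))
    ; 0<d   = 0<ε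
    ; N     = 0
    -- For the geometric sequence of ratio 1 - ε, `decay` with d = ε is an equality.
    ; decay = λ n _ → ℚ.≤-reflexive
        (solve 2 (λ ε t → ε :* t :+ (con 1ℚ :- ε) :* t := t) refl ε (r ^ℚ n))
    }
    where
    r = 1ℚ ℚ.- ε
    x≤r : ∀ k → K ℕ.≤ k → absAt (fin p pr) (seq x k) ℚ.≤ r
    x≤r k K≤k = +≤1⇒≤1- (x+ε≤1 k K≤k)
    0≤r = ℚ.≤-trans (absAt-nonNeg (fin p pr) (seq x K)) (x≤r K ℕ.≤-refl)

  -- Each term is bounded by 1, and by the ultrametric inequality adding terms does not raise the
  -- bound.
  partialSum-integral : ∀ {k} → absAt (fin p pr) (seq x k) ℚ.≤ 1ℚ → ∀ m →
                        absAt (fin p pr) (seq (partialSum (λ n → ι (b n) * x ^ n) m) k) ℚ.≤ 1ℚ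
  partialSum-integral x≤1 zero = ℚ.≤-trans (ℚ.≤-reflexive (absAt-0 (fin p pr))) (ℚ.nonNegative⁻¹ 1ℚ)
  partialSum-integral {k} x≤1 (suc m) = integral-+ p pr
    {seq (partialSum (λ n → ι (b n) * x ^ n) m) k} {seq (ι (b (suc m)) * x ^ suc m) k}
    (partialSum-integral x≤1 m)
    (begin
      absAt (fin p pr) (bₘ ℚ.* seq (x ^ suc m) k)     ≤⟨ absAt-monomial (fin p pr) x x≤1 bₘ (suc m) ⟩
      absAt (fin p pr) bₘ ℚ.* 1ℚ ^ℚ suc m             ≡⟨ cong (absAt (fin p pr) bₘ ℚ.*_) (1^ (suc m)) ⟩
      absAt (fin p pr) bₘ ℚ.* 1ℚ                      ≡⟨ ℚ.*-identityʳ _ ⟩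
      absAt (fin p pr) bₘ                             ≤⟨ b≤1 (suc m) ⟩
      1ℚ                                              ∎)
    where
    open ℚ.≤-Reasoning
    bₘ = b (suc m)
    1^ : ∀ n → 1ℚ ^ℚ n ≡ 1ℚ
    1^ zero    = refl
    1^ (suc n) = trans (ℚ.*-identityˡ (1ℚ ^ℚ n)) (1^ n)

  -- From index `K` on, every entry of `total` is a partial sum at an entry of `x` of absolute value
  -- at most 1.
  total-integral : (majorant : Majorant (λ n → ι (b n) * x ^ n)) → ∣ x ∣ < ι 1ℚ →
                   IsPAdicInteger p pr (Summation.total majorant)
  total-integral _ (ε , 0<ε , K , x+ε≤1) δ 0<δ = K , λ k K≤k → ℚ.≤-trans
    (partialSum-integral {k} (ℚ.≤-trans (≤+pos (ℚ.<⇒≤ 0<ε)) (x+ε≤1 k K≤k)) k) (≤+pos (ℚ.<⇒≤ 0<δ))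
    where
    ≤+pos : ∀ {q η} → 0ℚ ℚ.≤ η → q ℚ.≤ q ℚ.+ η
    ≤+pos {q} {η} 0≤η = subst (ℚ._≤ q ℚ.+ η) (ℚ.+-identityʳ q) (ℚ.+-monoʳ-≤ q 0≤η)

-- The series at the real place

module _ (a h : ℚ) (0≤h : 0ℚ ℚ.≤ h) (0≤r : 0ℚ ℚ.≤ 1ℚ ℚ.- (h ℚ.+ h)) where

  private
    r : ℚ
    r = 1ℚ ℚ.- (h ℚ.+ h)

    t : ℕ → ℚ
    t n = ℚ.∣ binom a n ∣ ℚ.* r ^ℚ n

    0≤t : ∀ n → 0ℚ ℚ.≤ t n
    0≤t n = 0≤* (ℚ.0≤∣p∣ (binom a n)) (0≤^ 0≤r n)

    0≤1+ : ∀ n → 0ℚ ℚ.≤ fromℕ n ℚ.+ 1ℚ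
    0≤1+ n = subst (0ℚ ℚ.≤_) (fromℕ-suc n) (0≤fromℕ (suc n))

  majorant-ratio : ∀ n → t (suc n) ℚ.* (fromℕ n ℚ.+ 1ℚ) ≡ t n ℚ.* (ℚ.∣ a ℚ.- fromℕ n ∣ ℚ.* r)
  majorant-ratio n = begin
    ℚ.∣ binom a (suc n) ∣ ℚ.* (r ℚ.* r ^ℚ n) ℚ.* (fromℕ n ℚ.+ 1ℚ)
      ≡⟨ cong (ℚ.∣ binom a (suc n) ∣ ℚ.* (r ℚ.* r ^ℚ n) ℚ.*_) (ℚ.0≤p⇒∣p∣≡p (0≤1+ n)) ⟨
    ℚ.∣ binom a (suc n) ∣ ℚ.* (r ℚ.* r ^ℚ n) ℚ.* ℚ.∣ fromℕ n ℚ.+ 1ℚ ∣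
      ≡⟨ solve 4 (λ b r s k → b :* (r :* s) :* k := (b :* k) :* (r :* s)) refl
           ℚ.∣ binom a (suc n) ∣ r (r ^ℚ n) ℚ.∣ fromℕ n ℚ.+ 1ℚ ∣ ⟩
    (ℚ.∣ binom a (suc n) ∣ ℚ.* ℚ.∣ fromℕ n ℚ.+ 1ℚ ∣) ℚ.* (r ℚ.* r ^ℚ n)
      ≡⟨ cong (ℚ._* (r ℚ.* r ^ℚ n)) (trans (sym (ℚ.∣p*q∣≡∣p∣*∣q∣ (binom a (suc n)) (fromℕ n ℚ.+ 1ℚ)))
           (trans (cong ℚ.∣_∣ (binom-ratio a n)) (ℚ.∣p*q∣≡∣p∣*∣q∣ (binom a n) (a ℚ.- fromℕ n)))) ⟩
    (ℚ.∣ binom a n ∣ ℚ.* ℚ.∣ a ℚ.- fromℕ n ∣) ℚ.* (r ℚ.* r ^ℚ n)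
      ≡⟨ solve 4 (λ b r s k → (b :* k) :* (r :* s) := b :* s :* (k :* r)) refl
           ℚ.∣ binom a n ∣ r (r ^ℚ n) ℚ.∣ a ℚ.- fromℕ n ∣ ⟩
    t n ℚ.* (ℚ.∣ a ℚ.- fromℕ n ∣ ℚ.* r) ∎
    where open ≡-Reasoning

  -- With k = n, |a| ≤ hk gives |a - k| ≤ (1 + h)k, and (1 + h)(1 - 2h) ≤ 1 - h. One half of the gap
  -- 2h absorbs `a`; the other remains as the decay rate.
  ratio-bound : ∀ n → ℚ.∣ a ∣ ℚ.≤ h ℚ.* fromℕ n →
                h ℚ.* (fromℕ n ℚ.+ 1ℚ) ℚ.+ ℚ.∣ a ℚ.- fromℕ n ∣ ℚ.* r ℚ.≤ fromℕ n ℚ.+ 1ℚ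
  ratio-bound n a≤hn = begin
    h ℚ.* (k ℚ.+ 1ℚ) ℚ.+ ℚ.∣ a ℚ.- k ∣ ℚ.* r
      ≤⟨ ℚ.+-monoʳ-≤ (h ℚ.* (k ℚ.+ 1ℚ)) (ℚ.*-monoʳ-≤-nonNeg r {{ℚ.nonNegative 0≤r}} ∣a-k∣≤) ⟩
    h ℚ.* (k ℚ.+ 1ℚ) ℚ.+ (h ℚ.* k ℚ.+ k) ℚ.* r
      ≡⟨ solve 2 (λ h k → h :* (k :+ con 1ℚ) :+ (h :* k :+ k) :* (con 1ℚ :- (h :+ h))
                   := (k :+ con 1ℚ) :- (h :+ (h :+ h) :* (h :* k) :+ (con 1ℚ :- (h :+ h)))) refl h k ⟩
    (k ℚ.+ 1ℚ) ℚ.- slack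
      ≤⟨ ℚ.+-monoʳ-≤ (k ℚ.+ 1ℚ) (ℚ.neg-antimono-≤ 0≤slack) ⟩
    (k ℚ.+ 1ℚ) ℚ.- 0ℚ
      ≡⟨ ℚ.+-identityʳ (k ℚ.+ 1ℚ) ⟩
    k ℚ.+ 1ℚ ∎
    where
    open ℚ.≤-Reasoning
    k = fromℕ n
    -- The amount by which the bound falls short of k + 1, arranged as a sum of nonnegative terms.
    slack = h ℚ.+ (h ℚ.+ h) ℚ.* (h ℚ.* k) ℚ.+ r
    0≤k : 0ℚ ℚ.≤ k
    0≤k = 0≤fromℕ n
    0≤slack : 0ℚ ℚ.≤ slack
    0≤slack = ℚ.+-mono-≤ (ℚ.+-mono-≤ 0≤h (0≤* (ℚ.+-mono-≤ 0≤h 0≤h) (0≤* 0≤h 0≤k))) 0≤r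
    ∣a-k∣≤ : ℚ.∣ a ℚ.- k ∣ ℚ.≤ h ℚ.* k ℚ.+ k
    ∣a-k∣≤ = ℚ.≤-trans (ℚ.∣p-q∣≤∣p∣+∣q∣ a k) (ℚ.+-mono-≤ a≤hn (ℚ.≤-reflexive (ℚ.0≤p⇒∣p∣≡p 0≤k)))

  binom-decay : ∀ n → ℚ.∣ a ∣ ℚ.≤ h ℚ.* fromℕ n → h ℚ.* t n ℚ.+ t (suc n) ℚ.≤ t n
  -- Multiplying by k + 1 > 0 clears the denominator of the ratio of consecutive terms.
  binom-decay n a≤hn = ℚ.*-cancelʳ-≤-pos (k ℚ.+ 1ℚ) {{ℚ.positive 0<k+1}} (begin
    (h ℚ.* t n ℚ.+ t (suc n)) ℚ.* (k ℚ.+ 1ℚ)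
      ≡⟨ ℚ.*-distribʳ-+ (k ℚ.+ 1ℚ) (h ℚ.* t n) (t (suc n)) ⟩
    h ℚ.* t n ℚ.* (k ℚ.+ 1ℚ) ℚ.+ t (suc n) ℚ.* (k ℚ.+ 1ℚ)
      ≡⟨ cong (h ℚ.* t n ℚ.* (k ℚ.+ 1ℚ) ℚ.+_) (majorant-ratio n) ⟩
    h ℚ.* t n ℚ.* (k ℚ.+ 1ℚ) ℚ.+ t n ℚ.* c
      ≡⟨ solve 4 (λ h t k c → h :* t :* k :+ t :* c := t :* (h :* k :+ c)) refl h (t n) (k ℚ.+ 1ℚ) c ⟩
    t n ℚ.* (h ℚ.* (k ℚ.+ 1ℚ) ℚ.+ c)
      ≤⟨ ℚ.*-monoˡ-≤-nonNeg (t n) {{ℚ.nonNegative (0≤t n)}} (ratio-bound n a≤hn) ⟩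
    t n ℚ.* (k ℚ.+ 1ℚ) ∎)
    where
    open ℚ.≤-Reasoning
    k = fromℕ n
    c = ℚ.∣ a ℚ.- k ∣ ℚ.* r
    0<k+1 : 0ℚ ℚ.< k ℚ.+ 1ℚ
    0<k+1 = ℚ.+-mono-≤-< (0≤fromℕ n) (ℚ.positive⁻¹ 1ℚ)

binomialMajorant : ∀ a {h} → 0ℚ ℚ.< h → ∀ N → ℚ.∣ a ∣ ℚ.≤ h ℚ.* fromℕ N →
                   ∀ (x : ℝ) K → (∀ k → K ℕ.≤ k → ℚ.∣ seq x k ∣ ℚ.≤ 1ℚ ℚ.- (h ℚ.+ h)) →
                   Majorant (λ n → ι (binom a n) * x ^ n)
binomialMajorant a {h} 0<h N ∣a∣≤hN x K x≤r = record
  { K     = K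
  ; t     = λ n → ℚ.∣ binom a n ∣ ℚ.* (1ℚ ℚ.- (h ℚ.+ h)) ^ℚ n
  ; bound = λ n k K≤k → absAt-monomial ∞ x (x≤r k K≤k) (binom a n) n
  ; 0<d   = 0<h
  ; N     = N
  -- The product hn grows with n, so the condition on |a| at `N` persists.
  ; decay = λ n N≤n → binom-decay a h (ℚ.<⇒≤ 0<h) 0≤r n (ℚ.≤-trans ∣a∣≤hN
      (ℚ.*-monoˡ-≤-nonNeg h {{ℚ.nonNegative (ℚ.<⇒≤ 0<h)}} (fromℕ-mono-≤ N≤n)))
  }
  where
  0≤r : 0ℚ ℚ.≤ 1ℚ ℚ.- (h ℚ.+ h)
  0≤r = ℚ.≤-trans (ℚ.0≤∣p∣ (seq x K)) (x≤r K ℕ.≤-refl)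

archimedeanMajorant : ∀ a (x : ℝ) → ∣ x ∣ < ι 1ℚ → Majorant (λ n → ι (binom a n) * x ^ n)
archimedeanMajorant a x (ε , 0<ε , K , x+ε≤1) =
  -- The gap ε = 2h matches r = 1 - 2h, and `N` is large enough that |a| ≤ hN.
  let h , 0<h , h+h≡ε = halve ε 0<ε
      N , ∣a∣≤hN = archimedean h 0<h ℚ.∣ a ∣
  in binomialMajorant a 0<h N ∣a∣≤hN x K λ k K≤k →
       subst (λ η → ℚ.∣ seq x k ∣ ℚ.≤ 1ℚ ℚ.- η) (sym h+h≡ε) (+≤1⇒≤1- (x+ε≤1 k K≤k))

-- Assembly of the local sums into an adele

theorem4p11 : (a : ℚ) →
    (∀ p .(pr : Prime p) → IsPAdicInteger p pr (ι a)) →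
    (x : ∀ v → ℚ[ v ]) →
    IsAdele x →
    (∀ v → ∣ x v ∣ < ι 1ℚ) →
    ∃[ Fx ] (∀ v → F[ a ] x v ≔ Fx v) × IsAdele Fx
-- The list of exceptions is empty: the bound |x| < 1 at every prime makes every p-adic sum
-- integral.
theorem4p11 a a∈ℤₚ x _ x<1 = Fx , converges , [] , λ p pr _ → integral p pr
  where
  majorant : ∀ v → Majorant (λ n → ι (binom a n) * x v ^ n)
  majorant ∞          = archimedeanMajorant a (x ∞) (x<1 ∞)
  majorant (fin p pr) =
    p-adicMajorant p pr (binom a) (binom-integral a a∈ℤₚ p pr) (x (fin p pr)) (x<1 (fin p pr))

  Fx : ∀ v → ℚ[ v ]
  Fx v = Summation.total (majorant v)

  converges : ∀ v → F[ a ] x v ≔ Fx v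
  converges v = Summation.partialSum-converges (majorant v)

  integral : ∀ p .(pr : Prime p) → IsPAdicInteger p pr (Fx (fin p pr))
  integral p pr = total-integral p pr (binom a) (binom-integral a a∈ℤₚ p pr) (x (fin p pr))
    (majorant (fin p pr)) (x<1 (fin p pr))
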